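{- For every positive integer $n$, the matrix $n\,G_n^{ -1}$ has integer entries, where $G_n := V_n^*\,V_n$ is the Gram matrix of the Vandermonde matrix $V_n$ associated with the $n$th cyclotomic polynomial.
   Context: For a positive integer $n$, let $m := \varphi(n)$ (Euler's totient function) and let $\zeta_1, \dots, \zeta_m \in \mathbb{C}$ be the primitive $n$th roots of unity (listed in any fixed order). The Vandermonde matrix associated with the $n$th cyclotomic polynomial is the $m \times m$ complex matrix $V_n := (\zeta_i^{\,j-1})_{1 \leq i,j \leq m}$; it is invertible since the $\zeta_i$ are distinct. $V_n^*$ denotes the conjugate transpose of $V_n$, and $G_n := V_n^*\,V_n$, which is an invertible $m \times m$ matrix. -}

module Defs where

open import Level using (0ℓ)
open import Algebra.Bundles.Raw using (RawRing)
import Algebra.Definitions.RawSemiring as RawSemiringDefs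
open import Data.Bool.Base using (if_then_else_)
open import Data.Fin.Base using (Fin; toℕ)
open import Data.Fin.Properties using (_≟_)
open import Data.Integer.Base using (ℤ)
open import Data.List.Base using (length; filter; map; upTo)
open import Data.Nat.Base as ℕ using (ℕ; suc)
open import Data.Nat.Coprimality using (coprime?)
import Data.Nat.Properties as ℕ
open import Data.Product.Base using (_×_; _,_; ∃-syntax)
open import Data.Rational.Base as ℚ using (ℚ; 0ℚ; 1ℚ; ½; ∣_∣; _<_; _≤_; Positive)
import Data.Rational.Properties as ℚ
open import Data.Rational.Solver using (module +-*-Solver)
open import Data.Vec.Functional using (Vector; transpose)
open import Function.Definitions using (Injective)
open import Relation.Binary.PropositionalEquality
  using (_≡_; refl; sym; trans; cong; subst)
open import Relation.Nullary.Decidable using (does)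
open import Relation.Nullary.Negation using (¬_)

-- The real numbers: Cauchy sequences of rationals, compared by the
-- equivalence relation "the difference tends to 0" (there are no quotients).

IsCauchy : (ℕ → ℚ) → Set
IsCauchy x = ∀ ε → 0ℚ < ε →
  ∃[ N ] (∀ p q → N ℕ.≤ p → N ℕ.≤ q → ∣ x p ℚ.- x q ∣ < ε)

record ℝ : Set where
  constructor mkℝ
  field
    seq    : ℕ → ℚ
    cauchy : IsCauchy seq

open ℝ public

infix 4 _≈ᴿ_
record _≈ᴿ_ (x y : ℝ) : Set where
  constructor mk≈ᴿ
  field
    converges : ∀ ε → 0ℚ < ε →
      ∃[ N ] (∀ p → N ℕ.≤ p → ∣ seq x p ℚ.- seq y p ∣ < ε)

private abstract
  half-pos : ∀ ε → 0ℚ < ε → 0ℚ < ½ ℚ.* ε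
  half-pos ε 0<ε = ℚ.*-monoʳ-<-pos ½ 0<ε

  half+half : ∀ ε → ½ ℚ.* ε ℚ.+ ½ ℚ.* ε ≡ ε
  half+half ε = trans (sym (ℚ.*-distribʳ-+ ε ½ ½)) (ℚ.*-identityˡ ε)

  +-interchange : ∀ a b c d →
    (a ℚ.+ b) ℚ.- (c ℚ.+ d) ≡ (a ℚ.- c) ℚ.+ (b ℚ.- d)
  +-interchange = solve 4 (λ a b c d →
    (a :+ b) :- (c :+ d) := (a :- c) :+ (b :- d)) refl
    where open +-*-Solver

  neg-sub : ∀ a c → (ℚ.- a) ℚ.- (ℚ.- c) ≡ ℚ.- (a ℚ.- c)
  neg-sub = solve 2 (λ a c → (:- a) :- (:- c) := :- (a :- c)) refl
    where open +-*-Solver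

  *-split : ∀ a b c d →
    a ℚ.* b ℚ.- c ℚ.* d ≡ a ℚ.* (b ℚ.- d) ℚ.+ d ℚ.* (a ℚ.- c)
  *-split = solve 4 (λ a b c d →
    a :* b :- c :* d := a :* (b :- d) :+ d :* (a :- c)) refl
    where open +-*-Solver

  sub-add : ∀ a b → a ≡ (a ℚ.- b) ℚ.+ b
  sub-add = solve 2 (λ a b → a := (a :- b) :+ b) refl
    where open +-*-Solver

  0<1 : 0ℚ < 1ℚ
  0<1 = ℚ.positive⁻¹ 1ℚ

  eventuallyBounded : ∀ x → IsCauchy x →
    ∃[ B ] (0ℚ < B × ∃[ N ] (∀ p → N ℕ.≤ p → ∣ x p ∣ ≤ B))
  eventuallyBounded x cx with cx 1ℚ 0<1
  ... | N , h = 1ℚ ℚ.+ ∣ x N ∣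
              , ℚ.+-mono-<-≤ 0<1 (ℚ.0≤∣p∣ (x N))
              , N , λ p N≤p → begin
                  ∣ x p ∣                        ≡⟨ cong ∣_∣ (sub-add (x p) (x N)) ⟩
                  ∣ (x p ℚ.- x N) ℚ.+ x N ∣       ≤⟨ ℚ.∣p+q∣≤∣p∣+∣q∣ (x p ℚ.- x N) (x N) ⟩
                  ∣ x p ℚ.- x N ∣ ℚ.+ ∣ x N ∣     ≤⟨ ℚ.+-monoˡ-≤ ∣ x N ∣ (ℚ.<⇒≤ (h p N N≤p ℕ.≤-refl)) ⟩
                  1ℚ ℚ.+ ∣ x N ∣                 ∎
    where open ℚ.≤-Reasoning

  absorb : ∀ B ε → 0ℚ < B → 0ℚ < ε →
    ∃[ δ ] (0ℚ < δ × (∀ a b → ∣ a ∣ ≤ B → ∣ b ∣ < δ → ∣ a ℚ.* b ∣ < ε))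
  absorb B ε 0<B 0<ε = ℚ.1/ B ℚ.* ε , 0<δ , small
    where
    open ℚ.≤-Reasoning
    instance
      B-pos : Positive B
      B-pos = ℚ.positive 0<B
      B-nonZero : ℚ.NonZero B
      B-nonZero = ℚ.pos⇒nonZero B

    0<δ : 0ℚ < ℚ.1/ B ℚ.* ε
    0<δ = ℚ.positive⁻¹ (ℚ.1/ B ℚ.* ε)
      {{ℚ.pos*pos⇒pos (ℚ.1/ B) {{ℚ.1/pos⇒pos B}} ε {{ℚ.positive 0<ε}}}}

    small : ∀ a b → ∣ a ∣ ≤ B → ∣ b ∣ < ℚ.1/ B ℚ.* ε → ∣ a ℚ.* b ∣ < ε
    small a b ∣a∣≤B ∣b∣<δ = begin-strict
      ∣ a ℚ.* b ∣            ≡⟨ ℚ.∣p*q∣≡∣p∣*∣q∣ a b ⟩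
      ∣ a ∣ ℚ.* ∣ b ∣         ≤⟨ ℚ.*-monoʳ-≤-nonNeg ∣ b ∣ {{ℚ.∣-∣-nonNeg b}} ∣a∣≤B ⟩
      B ℚ.* ∣ b ∣            <⟨ ℚ.*-monoʳ-<-pos B ∣b∣<δ ⟩
      B ℚ.* (ℚ.1/ B ℚ.* ε)  ≡⟨ ℚ.*-assoc B (ℚ.1/ B) ε ⟨
      B ℚ.* ℚ.1/ B ℚ.* ε    ≡⟨ cong (ℚ._* ε) (ℚ.*-inverseʳ B) ⟩
      1ℚ ℚ.* ε              ≡⟨ ℚ.*-identityˡ ε ⟩
      ε                     ∎

  sum-small : ∀ u v ε → ∣ u ∣ < ½ ℚ.* ε → ∣ v ∣ < ½ ℚ.* ε → ∣ u ℚ.+ v ∣ < ε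
  sum-small u v ε hu hv = begin-strict
    ∣ u ℚ.+ v ∣            ≤⟨ ℚ.∣p+q∣≤∣p∣+∣q∣ u v ⟩
    ∣ u ∣ ℚ.+ ∣ v ∣         <⟨ ℚ.+-mono-< hu hv ⟩
    ½ ℚ.* ε ℚ.+ ½ ℚ.* ε  ≡⟨ half+half ε ⟩
    ε                     ∎
    where open ℚ.≤-Reasoning

abstract
  const-cauchy : ∀ r → IsCauchy (λ _ → r)
  const-cauchy r ε 0<ε = 0 , λ _ _ _ _ →
    subst (_< ε) (sym (cong ∣_∣ (ℚ.+-inverseʳ r))) 0<ε

  neg-cauchy : ∀ x → IsCauchy x → IsCauchy (λ p → ℚ.- x p)
  neg-cauchy x cx ε 0<ε with cx ε 0<ε
  ... | N , h = N , λ p q N≤p N≤q →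
    subst (_< ε)
      (sym (trans (cong ∣_∣ (neg-sub (x p) (x q))) (ℚ.∣-p∣≡∣p∣ (x p ℚ.- x q))))
      (h p q N≤p N≤q)

  +-cauchy : ∀ x y → IsCauchy x → IsCauchy y → IsCauchy (λ p → x p ℚ.+ y p)
  +-cauchy x y cx cy ε 0<ε
    with cx (½ ℚ.* ε) (half-pos ε 0<ε) | cy (½ ℚ.* ε) (half-pos ε 0<ε)
  ... | M , h | N , k = M ℕ.⊔ N , λ p q ≤p ≤q →
    subst (_< ε)
      (cong ∣_∣ (sym (+-interchange (x p) (y p) (x q) (y q))))
      (sum-small (x p ℚ.- x q) (y p ℚ.- y q) ε
        (h p q (ℕ.m⊔n≤o⇒m≤o M N ≤p) (ℕ.m⊔n≤o⇒m≤o M N ≤q))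
        (k p q (ℕ.m⊔n≤o⇒n≤o M N ≤p) (ℕ.m⊔n≤o⇒n≤o M N ≤q)))

  *-cauchy : ∀ x y → IsCauchy x → IsCauchy y → IsCauchy (λ p → x p ℚ.* y p)
  *-cauchy x y cx cy ε 0<ε =
    let A , 0<A , K , ∣x∣≤A = eventuallyBounded x cx
        B , 0<B , L , ∣y∣≤B = eventuallyBounded y cy
        α , 0<α , smallˡ = absorb A (½ ℚ.* ε) 0<A (half-pos ε 0<ε)
        β , 0<β , smallʳ = absorb B (½ ℚ.* ε) 0<B (half-pos ε 0<ε)
        M , h = cy α 0<α
        N , k = cx β 0<β
    in (K ℕ.⊔ L) ℕ.⊔ (M ℕ.⊔ N) , λ p q ≤p ≤q →
    let KL≤p = ℕ.m⊔n≤o⇒m≤o (K ℕ.⊔ L) (M ℕ.⊔ N) ≤p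
        KL≤q = ℕ.m⊔n≤o⇒m≤o (K ℕ.⊔ L) (M ℕ.⊔ N) ≤q
        MN≤p = ℕ.m⊔n≤o⇒n≤o (K ℕ.⊔ L) (M ℕ.⊔ N) ≤p
        MN≤q = ℕ.m⊔n≤o⇒n≤o (K ℕ.⊔ L) (M ℕ.⊔ N) ≤q
    in subst (_< ε)
      (cong ∣_∣ (sym (*-split (x p) (y p) (x q) (y q))))
      (sum-small (x p ℚ.* (y p ℚ.- y q)) (y q ℚ.* (x p ℚ.- x q)) ε
        (smallˡ (x p) (y p ℚ.- y q) (∣x∣≤A p (ℕ.m⊔n≤o⇒m≤o K L KL≤p))
          (h p q (ℕ.m⊔n≤o⇒m≤o M N MN≤p) (ℕ.m⊔n≤o⇒m≤o M N MN≤q)))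
        (smallʳ (y q) (x p ℚ.- x q) (∣y∣≤B q (ℕ.m⊔n≤o⇒n≤o K L KL≤q))
          (k p q (ℕ.m⊔n≤o⇒n≤o M N MN≤p) (ℕ.m⊔n≤o⇒n≤o M N MN≤q))))

fromℚ : ℚ → ℝ
fromℚ r = mkℝ (λ _ → r) (const-cauchy r)

infix  8 -ᴿ_
infixl 7 _*ᴿ_
infixl 6 _+ᴿ_ _-ᴿ_

_+ᴿ_ : ℝ → ℝ → ℝ
x +ᴿ y = mkℝ (λ p → seq x p ℚ.+ seq y p) (+-cauchy (seq x) (seq y) (cauchy x) (cauchy y))

_*ᴿ_ : ℝ → ℝ → ℝ
x *ᴿ y = mkℝ (λ p → seq x p ℚ.* seq y p) (*-cauchy (seq x) (seq y) (cauchy x) (cauchy y))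

-ᴿ_ : ℝ → ℝ
-ᴿ x = mkℝ (λ p → ℚ.- seq x p) (neg-cauchy (seq x) (cauchy x))

_-ᴿ_ : ℝ → ℝ → ℝ
x -ᴿ y = x +ᴿ (-ᴿ y)

record ℂ : Set where
  constructor _+i_
  field
    re im : ℝ

open ℂ public

infix 4 _≈ᶜ_
record _≈ᶜ_ (z w : ℂ) : Set where
  constructor mk≈ᶜ
  field
    re-≈ : re z ≈ᴿ re w
    im-≈ : im z ≈ᴿ im w

ℂ-rawRing : RawRing 0ℓ 0ℓ
ℂ-rawRing = record
  { Carrier = ℂ
  ; _≈_     = _≈ᶜ_
  ; _+_     = λ z w → (re z +ᴿ re w) +i (im z +ᴿ im w)
  ; _*_     = λ z w → (re z *ᴿ re w -ᴿ im z *ᴿ im w) +i (re z *ᴿ im w +ᴿ im z *ᴿ re w)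
  ; -_      = λ z → (-ᴿ re z) +i (-ᴿ im z)
  ; 0#      = fromℚ 0ℚ +i fromℚ 0ℚ
  ; 1#      = fromℚ 1ℚ +i fromℚ 0ℚ
  }

open RawRing ℂ-rawRing public using (_≈_; _+_; _*_; -_; 0#; 1#)
open RawSemiringDefs (RawRing.rawSemiring ℂ-rawRing) public using (_^_; sum)

conj : ℂ → ℂ
conj z = re z +i (-ᴿ im z)

fromℤ : ℤ → ℂ
fromℤ k = fromℚ (k ℚ./ 1) +i fromℚ 0ℚ

Matrix : ℕ → ℕ → Set
Matrix r c = Fin r → Fin c → ℂ

infix 4 _≋_
_≋_ : ∀ {r c} → Matrix r c → Matrix r c → Set
A ≋ B = ∀ i j → A i j ≈ B i j

infixl 7 _⊗_
_⊗_ : ∀ {r s c} → Matrix r s → Matrix s c → Matrix r c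
(A ⊗ B) i j = sum (λ k → A i k * B k j)

identity : ∀ {r} → Matrix r r
identity i j = if does (i ≟ j) then 1# else 0#

infixr 7 _·_
_·_ : ∀ {r c} → ℂ → Matrix r c → Matrix r c
(z · A) i j = z * A i j

infix 9 _ᴴ
_ᴴ : ∀ {r c} → Matrix r c → Matrix c r
(A ᴴ) i j = conj (transpose A i j)

IsInverse : ∀ {r} → Matrix r r → Matrix r r → Set
IsInverse A B = A ⊗ B ≋ identity × B ⊗ A ≋ identity

HasIntegerEntries : ∀ {r c} → Matrix r c → Set
HasIntegerEntries A = ∀ i j → ∃[ k ] A i j ≈ fromℤ k

φ : ℕ → ℕ
φ n = length (filter (λ k → coprime? k n) (map suc (upTo n)))

IsPrimitiveRoot : ℕ → ℂ → Set
IsPrimitiveRoot n z = z ^ n ≈ 1# × (∀ k → 0 ℕ.< k → k ℕ.< n → ¬ (z ^ k ≈ 1#))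

-- ζ lists every primitive n-th root of unity exactly once, in some order.
record ListsPrimitiveRoots (n : ℕ) {m : ℕ} (ζ : Vector ℂ m) : Set where
  field
    sound    : ∀ i → IsPrimitiveRoot n (ζ i)
    distinct : Injective _≡_ _≈_ ζ
    complete : ∀ z → IsPrimitiveRoot n z → ∃[ i ] ζ i ≈ z

-- Indices start at 0, so the exponent is j where 1-based indexing has j - 1.
vandermonde : ∀ {m} → Vector ℂ m → Matrix m m
vandermonde ζ i j = ζ i ^ toℕ j

gram : ∀ {m} → Vector ℂ m → Matrix m m
gram ζ = vandermonde ζ ᴴ ⊗ vandermonde ζ

{-# OPTIONS --safe #-}
module Submission where

-- Let W be the matrix (ζᵢᵏ) with 0 ≤ k < n.  Reducing xᵏ modulo the n-th cyclotomic
-- polynomial, which is monic with integer coefficients, gives W = V A with A an integer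
-- matrix.  The rows of W are orthogonal: W Wᴴ = n I.  With B = A Aᴴ and G = Vᴴ V,
-- V (B G) = (W Wᴴ) V = n V, and V is injective, so B G = n I, that is n G⁻¹ = A Aᴴ.
--
-- For the integrality, fix a primitive root ω and group the factors of
-- Xⁿ − 1 = ∏ (X − ωᵏ) by g = gcd k n.  The k divisible by g contribute X^(n/g) − 1, and
-- monic division by integer polynomials isolates each group, from the largest g down
-- to g = 1.

-- Equality of Cauchy reals is undecidable and `¬ z ≈ 0#` yields no inverse of `z`. What it does
-- yield is cancellation, `Regular z`, and every use of distinctness or of exact order is phrased
-- through it; this also lets the cyclotomic part run over an arbitrary commutative ring. The
-- descent in g works because the k divisible by g split into the classes gcd k n = h with g ∣ h ∣
-- n, and every class but h = g itself has h > g. The resulting polynomial is built from powers of ω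
-- alone. That each ζᵢ is a root of it follows by cancelling the factors ζᵢ - ωᵏ with k not coprime
-- to n, without writing ζᵢ as a power of ω. Orthogonality rests on conj ζ being the inverse of ζ.
-- This is drawn from ζⁿ = 1 by positivity, without exponentials or arguments.

open import Level using (Level; 0ℓ)
open import Algebra.Bundles using (CommutativeRing)
import Algebra.Properties.CommutativeSemiring.Exp as Exp
import Algebra.Properties.Ring as RingProperties
import Algebra.Properties.Semiring.Sum as SemiringSum
import Algebra.Solver.Ring as RingSolver
open import Algebra.Solver.Ring.AlmostCommutativeRing
  using (fromCommutativeRing; _-Raw-AlmostCommutative⟶_)
open import Algebra.Structures using (IsCommutativeRing)
open import Data.Fin.Base using (Fin; zero; suc; toℕ; inject₁; fromℕ)
import Data.Fin.Properties as Fin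
open import Data.Integer.Base as ℤ using (ℤ; +_)
import Data.Integer.Properties as ℤ
open import Data.Integer.Solver using () renaming (module +-*-Solver to ℤ-Solver)
open import Data.Nat.Base as ℕ using (ℕ; zero; suc; NonZero)
import Data.Nat.Properties as ℕ
open import Data.Nat.Solver using () renaming (module +-*-Solver to ℕ-Solver)
open import Data.Product.Base using (Σ-syntax; ∃-syntax; _×_; _,_; proj₁; proj₂)
open import Data.Sum.Base as Sum using (_⊎_; inj₁; inj₂)
open import Data.Vec.Functional as Vec using (Vector; head; tail; init; last)
open import Function.Base using (_∘_; id)
open import Relation.Binary.PropositionalEquality as ≡ using (_≡_; _≢_)
import Relation.Binary.Reasoning.Setoid as SetoidReasoning
open import Relation.Nullary using (¬_; yes; no; contradiction)

-- Lists of natural numbers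

module Lists where

  open import Data.List.Base using (List; []; _∷_; _++_; length; map; upTo; filter)
  import Data.List.Properties as List
  open import Data.List.Membership.Propositional using (_∈_)
  open import Data.List.Membership.Propositional.Properties
    using (∈-map⁺; ∈-map⁻; ∈-filter⁺; ∈-filter⁻; ∈-upTo⁺; ∈-upTo⁻)
  open import Data.List.Membership.Propositional.Properties.WithK using (unique∧set⇒bag)
  open import Data.List.Relation.Binary.BagAndSetEquality using (∼bag⇒↭)
  open import Data.List.Relation.Binary.Permutation.Propositional
    using (_↭_; refl; prep; ↭-sym; ↭-trans)
  open import Data.List.Relation.Binary.Permutation.Propositional.Properties using (shift)
  open import Data.List.Relation.Unary.Unique.Propositional using (Unique)
  import Data.List.Relation.Unary.Unique.Propositional.Properties as Unique
  open import Data.Nat.Divisibility using (_∣_; _∣?_; divides; m∣m*n)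
  open import Function.Bundles using (mk⇔)
  open import Relation.Unary using (Pred; Decidable)

  sameElements⇒↭ : {A : Set} {xs ys : List A} → Unique xs → Unique ys →
    (∀ {x} → x ∈ xs → x ∈ ys) → (∀ {x} → x ∈ ys → x ∈ xs) → xs ↭ ys
  sameElements⇒↭ xs! ys! xs⊆ys ys⊆xs = ∼bag⇒↭ (unique∧set⇒bag xs! ys! (mk⇔ xs⊆ys ys⊆xs))

  module _ {A : Set} {p q r : Level} {P : Pred A p} {Q : Pred A q} {R : Pred A r}
    (P? : Decidable P) (Q? : Decidable Q) (R? : Decidable R)
    (R⇒P⊎Q : ∀ {x} → R x → P x ⊎ Q x) (P⇒R : ∀ {x} → P x → R x) (Q⇒R : ∀ {x} → Q x → R x)
    (disjoint : ∀ {x} → P x → ¬ Q x) where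

    filter-⊎-↭ : ∀ xs → filter R? xs ↭ filter P? xs ++ filter Q? xs
    filter-⊎-↭ [] = refl
    filter-⊎-↭ (x ∷ xs) with R? x
    ... | no ¬r rewrite List.filter-reject P? {xs = xs} (¬r ∘ P⇒R) | List.filter-reject Q? {xs = xs} (¬r ∘ Q⇒R) =
      filter-⊎-↭ xs
    ... | yes r with R⇒P⊎Q r
    ...   | inj₁ p rewrite List.filter-accept P? {xs = xs} p | List.filter-reject Q? {xs = xs} (disjoint p) =
      prep x (filter-⊎-↭ xs)
    ...   | inj₂ q rewrite List.filter-reject P? {xs = xs} (λ p → disjoint p q) | List.filter-accept Q? {xs = xs} q =
      ↭-trans (prep x (filter-⊎-↭ xs)) (↭-sym (shift x (filter P? xs) (filter Q? xs)))

  range : ℕ → List ℕ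
  range d = map suc (upTo d)

  range-∷ʳ : ∀ d → range (suc d) ≡ range d ++ suc d ∷ []
  range-∷ʳ d = ≡.trans (≡.cong (map suc) (≡.sym (List.upTo-∷ʳ d))) (List.map-++ suc (upTo d) (d ∷ []))

  length-range : ∀ d → length (range d) ≡ d
  length-range d = ≡.trans (List.length-map suc (upTo d)) (List.length-upTo d)

  ∈-range⁺ : ∀ {d k} → 0 ℕ.< k → k ℕ.≤ d → k ∈ range d
  ∈-range⁺ {k = suc k} _ k<d = ∈-map⁺ suc (∈-upTo⁺ k<d)

  ∈-range⁻ : ∀ {d k} → k ∈ range d → 0 ℕ.< k × k ℕ.≤ d
  ∈-range⁻ k∈ with ∈-map⁻ suc k∈
  ... | _ , j∈ , ≡.refl = ℕ.z<s , ∈-upTo⁻ j∈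

  range-unique : ∀ d → Unique (range d)
  range-unique d = Unique.map⁺ ℕ.suc-injective (Unique.upTo⁺ d)

  -- Reindexing by `k = g * j` turns the factors with `g ∣ k` into the full set of factors of the
  -- root `ω ^ g`, to which `RootsOfUnity` applies.
  multiples-↭ : ∀ g d → .{{NonZero g}} → filter (g ∣?_) (range (g ℕ.* d)) ↭ map (g ℕ.*_) (range d)
  multiples-↭ g d = sameElements⇒↭
    (Unique.filter⁺ (g ∣?_) (range-unique (g ℕ.* d)))
    (Unique.map⁺ (λ {x} {y} → ℕ.*-cancelˡ-≡ x y g) (range-unique d))
    to from
    where
    to : ∀ {k} → k ∈ filter (g ∣?_) (range (g ℕ.* d)) → k ∈ map (g ℕ.*_) (range d)
    to {k} k∈ with ∈-filter⁻ (g ∣?_) {xs = range (g ℕ.* d)} k∈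
    ... | k∈range , divides q k≡qg with ∈-range⁻ k∈range
    ...   | 0<k , k≤gd = ≡.subst (_∈ map (g ℕ.*_) (range d)) (≡.sym k≡gq)
            (∈-map⁺ (g ℕ.*_) (∈-range⁺
              (ℕ.*-cancelˡ-< g 0 q (≡.subst₂ ℕ._<_ (≡.sym (ℕ.*-zeroʳ g)) k≡gq 0<k))
              (ℕ.*-cancelˡ-≤ g (≡.subst (ℕ._≤ g ℕ.* d) k≡gq k≤gd))))
      where
      k≡gq : k ≡ g ℕ.* q
      k≡gq = ≡.trans k≡qg (ℕ.*-comm q g)

    from : ∀ {k} → k ∈ map (g ℕ.*_) (range d) → k ∈ filter (g ∣?_) (range (g ℕ.* d))
    from k∈ with ∈-map⁻ (g ℕ.*_) k∈
    ... | j , j∈ , ≡.refl with ∈-range⁻ j∈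
    ...   | 0<j , j≤d = ∈-filter⁺ (g ∣?_)
      (∈-range⁺ (≡.subst (ℕ._< g ℕ.* j) (ℕ.*-zeroʳ g) (ℕ.*-monoʳ-< g 0<j)) (ℕ.*-monoʳ-≤ g j≤d))
      (m∣m*n j)

-- Cyclotomic polynomials over a commutative ring

module Cyclotomic {c ℓ : Level} (R : CommutativeRing c ℓ)
  (ι : CommutativeRing.rawRing ℤ.+-*-commutativeRing -Raw-AlmostCommutative⟶ fromCommutativeRing R) where

  open Lists
  open import Data.List.Base using (List; []; _∷_; _++_; length; map; upTo; filter)
  import Data.List.Properties as List
  open import Data.List.Relation.Binary.Permutation.Propositional
    using (_↭_; refl; prep; swap; trans; ↭-sym; ↭-reflexive; ↭-trans)
  open import Data.List.Relation.Binary.Permutation.Propositional.Properties using (∷↭∷ʳ)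
  open import Data.List.Relation.Unary.All as All using (All; []; _∷_)
  open import Data.List.Relation.Unary.All.Properties using (all-filter)
  open import Data.Maybe.Base using (Maybe; just; nothing)
  open import Data.Nat.Coprimality using (Coprime; coprime?; coprime⇒gcd≡1; gcd≡1⇒coprime)
  open import Data.Nat.Divisibility using (_∣_; _∣?_; 1∣_; divides; ∣⇒≤; ∣-trans)
  open import Data.Nat.GCD using (gcd; gcd[m,n]∣m; gcd[m,n]∣n; gcd-greatest; gcd[m,n]≢0)
  open import Data.Unit.Base using (tt)
  open import Relation.Binary.Definitions using (tri<; tri≈; tri>)
  open import Relation.Nullary.Decidable using (¬?; _×-dec_; toSum)
  open import Relation.Unary.Properties using (U?)

  open CommutativeRing R hiding (zero) renaming (refl to ≈-refl; sym to ≈-sym; trans to ≈-trans)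
  open RingProperties ring using (-0#≈0#)
  open Exp commutativeSemiring using (_^_; ^-assocʳ; ^-congˡ; ^-congʳ)
  open SemiringSum semiring using (sum; sum-cong-≋; sum-init-last; *-distribˡ-sum)
  open _-Raw-AlmostCommutative⟶_ ι using (⟦_⟧; +-homo; *-homo; -‿homo; 0-homo; 1-homo)
  open SetoidReasoning setoid

  private
    coefficient≟ : ∀ a b → Maybe (⟦ a ⟧ ≈ ⟦ b ⟧)
    coefficient≟ a b with a ℤ.≟ b
    ... | yes a≡b = just (reflexive (≡.cong ⟦_⟧ a≡b))
    ... | no _    = nothing

  module Solver = RingSolver (CommutativeRing.rawRing ℤ.+-*-commutativeRing) (fromCommutativeRing R) ι coefficient≟
  open Solver using (solve; _:=_; _:+_; _:*_; _:-_; :-_)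

  private variable
    I J : Set
    r r′ : I → Carrier
    f g : ℕ → Carrier
    a b z : Carrier

  -- Stands in for being nonzero: closed under products, and for complex numbers a consequence of
  -- `¬ z ≈ 0#` (`≉0⇒regular`), whereas an inverse is not at hand.
  Regular : Carrier → Set _
  Regular z = ∀ w → z * w ≈ 0# → w ≈ 0#

  Integral : Carrier → Set _
  Integral z = ∃[ k ] z ≈ ⟦ k ⟧

  Integral-resp : a ≈ b → Integral a → Integral b
  Integral-resp a≈b (k , a≈k) = k , ≈-trans (≈-sym a≈b) a≈k

  Integral-0 : Integral 0#
  Integral-0 = ℤ.+ 0 , ≈-sym 0-homo

  Integral-1 : Integral 1#
  Integral-1 = ℤ.+ 1 , ≈-sym 1-homo

  Integral-+ : Integral a → Integral b → Integral (a + b)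
  Integral-+ (k , a≈k) (l , b≈l) = k ℤ.+ l , ≈-trans (+-cong a≈k b≈l) (≈-sym (+-homo k l))

  Integral-* : Integral a → Integral b → Integral (a * b)
  Integral-* (k , a≈k) (l , b≈l) = k ℤ.* l , ≈-trans (*-cong a≈k b≈l) (≈-sym (*-homo k l))

  Integral-neg : Integral a → Integral (- a)
  Integral-neg (k , a≈k) = ℤ.- k , ≈-trans (-‿cong a≈k) (≈-sym (-‿homo k))

  -- Reversed monic polynomials are handled as power series f₀ + f₁ X + ⋯.

  a-b*0≈a : ∀ a b → a - b * 0# ≈ a
  a-b*0≈a a b = begin
    a - b * 0#    ≈⟨ +-congˡ (-‿cong (zeroʳ b)) ⟩
    a - 0#        ≈⟨ +-congˡ -0#≈0# ⟩
    a + 0#        ≈⟨ +-identityʳ a ⟩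
    a             ∎

  a-b≈0⇒a≈b : a - b ≈ 0# → a ≈ b
  a-b≈0⇒a≈b {a} {b} a-b≈0 = begin
    a              ≈⟨ solve 2 (λ a b → a := (a :- b) :+ b) ≈-refl a b ⟩
    (a - b) + b    ≈⟨ +-congʳ a-b≈0 ⟩
    0# + b         ≈⟨ +-identityˡ b ⟩
    b              ∎

  a≈b⇒a-b≈0 : a ≈ b → a - b ≈ 0#
  a≈b⇒a-b≈0 {a} {b} a≈b = ≈-trans (+-congʳ a≈b) (-‿inverseʳ b)

  infix 4 _≐_
  _≐_ : (f g : ℕ → Carrier) → Set _
  f ≐ g = ∀ j → f j ≈ g j

  one : ℕ → Carrier
  one zero    = 1#
  one (suc _) = 0#

  [1-_X]*_ : Carrier → (ℕ → Carrier) → ℕ → Carrier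
  ([1- a X]* f) zero    = f zero
  ([1- a X]* f) (suc j) = f (suc j) - a * f j

  ∏[1-_X] : (I → Carrier) → List I → ℕ → Carrier
  ∏[1- r X] []       = one
  ∏[1- r X] (k ∷ ks) = [1- r k X]* (∏[1- r X] ks)

  [1-X]-cong : a ≈ b → f ≐ g → [1- a X]* f ≐ [1- b X]* g
  [1-X]-cong a≈b f≐g zero    = f≐g zero
  [1-X]-cong a≈b f≐g (suc j) = +-cong (f≐g (suc j)) (-‿cong (*-cong a≈b (f≐g j)))

  [1-X]-comm : ∀ a b f → [1- a X]* ([1- b X]* f) ≐ [1- b X]* ([1- a X]* f)
  [1-X]-comm a b f zero          = ≈-refl
  [1-X]-comm a b f (suc zero)    =
    solve 4 (λ a b f₀ f₁ → (f₁ :- b :* f₀) :- a :* f₀ := (f₁ :- a :* f₀) :- b :* f₀) ≈-refl a b (f 0) (f 1)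
  [1-X]-comm a b f (suc (suc j)) =
    solve 5 (λ a b f₀ f₁ f₂ → (f₂ :- b :* f₁) :- a :* (f₁ :- b :* f₀) := (f₂ :- a :* f₁) :- b :* (f₁ :- a :* f₀))
      ≈-refl a b (f j) (f (suc j)) (f (suc (suc j)))

  ∏-cong : (∀ k → r k ≈ r′ k) → ∀ ks → ∏[1- r X] ks ≐ ∏[1- r′ X] ks
  ∏-cong r≈r′ []       j = ≈-refl
  ∏-cong r≈r′ (k ∷ ks)   = [1-X]-cong (r≈r′ k) (∏-cong r≈r′ ks)

  ∏-↭ : ∀ (r : I → Carrier) {ks ls} → ks ↭ ls → ∏[1- r X] ks ≐ ∏[1- r X] ls
  ∏-↭ r refl j = ≈-refl
  ∏-↭ r (prep k p) = [1-X]-cong ≈-refl (∏-↭ r p)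
  ∏-↭ r (swap {xs} k l p) j = ≈-trans ([1-X]-comm (r k) (r l) (∏[1- r X] xs) j)
    ([1-X]-cong ≈-refl ([1-X]-cong ≈-refl (∏-↭ r p)) j)
  ∏-↭ r (trans p q) j = ≈-trans (∏-↭ r p j) (∏-↭ r q j)

  ∏-map : ∀ (r : I → Carrier) (h : J → I) ks → ∏[1- r X] (map h ks) ≐ ∏[1- r ∘ h X] ks
  ∏-map r h []       j = ≈-refl
  ∏-map r h (k ∷ ks)   = [1-X]-cong ≈-refl (∏-map r h ks)

  ∏-constant : ∀ (r : I → Carrier) ks → ∏[1- r X] ks 0 ≈ 1#
  ∏-constant r []       = ≈-refl
  ∏-constant r (k ∷ ks) = ∏-constant r ks

  ∏-degree : ∀ (r : I → Carrier) ks {j} → length ks ℕ.< j → ∏[1- r X] ks j ≈ 0#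
  ∏-degree r []       {suc j} _               = ≈-refl
  ∏-degree r (k ∷ ks) {suc j} (ℕ.s≤s len<j) = begin
    ∏[1- r X] ks (suc j) - r k * ∏[1- r X] ks j
      ≈⟨ +-cong (∏-degree r ks (ℕ.m<n⇒m<1+n len<j)) (-‿cong (*-congˡ (∏-degree r ks len<j))) ⟩
    0# - r k * 0#
      ≈⟨ a-b*0≈a 0# (r k) ⟩
    0# ∎

  -- This is the substitution of `a X` for `X`.
  ∏-scale : ∀ a (r : I → Carrier) ks j → ∏[1- (λ k → a * r k) X] ks j ≈ a ^ j * ∏[1- r X] ks j
  ∏-scale a r []       zero    = ≈-sym (*-identityˡ 1#)
  ∏-scale a r []       (suc j) = ≈-sym (zeroʳ (a ^ suc j))
  ∏-scale a r (k ∷ ks) zero    = ∏-scale a r ks zero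
  ∏-scale a r (k ∷ ks) (suc j) = begin
    ∏[1- (λ k → a * r k) X] ks (suc j) - a * r k * ∏[1- (λ k → a * r k) X] ks j
      ≈⟨ +-cong (∏-scale a r ks (suc j)) (-‿cong (*-congˡ (∏-scale a r ks j))) ⟩
    a * a ^ j * ∏[1- r X] ks (suc j) - a * r k * (a ^ j * ∏[1- r X] ks j)
      ≈⟨ solve 5 (λ a aʲ r f g → a :* aʲ :* f :- a :* r :* (aʲ :* g) := a :* aʲ :* (f :- r :* g))
           ≈-refl a (a ^ j) (r k) (∏[1- r X] ks (suc j)) (∏[1- r X] ks j) ⟩
    a * a ^ j * (∏[1- r X] ks (suc j) - r k * ∏[1- r X] ks j) ∎

  -- Cauchy products and integrality of quotients.

  infixl 7 _⋆_
  -- The Cauchy product of power series; the recursion follows the decomposition of `f` as `f 0`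
  -- plus `X` times `f ∘ suc`.
  _⋆_ : (f g : ℕ → Carrier) → ℕ → Carrier
  (f ⋆ g) zero    = f 0 * g 0
  (f ⋆ g) (suc j) = f 0 * g (suc j) + ((f ∘ suc) ⋆ g) j

  ⋆-congʳ : ∀ g {f f′} → f ≐ f′ → f ⋆ g ≐ f′ ⋆ g
  ⋆-congʳ g f≐f′ zero    = *-congʳ (f≐f′ 0)
  ⋆-congʳ g f≐f′ (suc j) = +-cong (*-congʳ (f≐f′ 0)) (⋆-congʳ g (f≐f′ ∘ suc) j)

  0-⋆ : ∀ g → (λ _ → 0#) ⋆ g ≐ (λ _ → 0#)
  0-⋆ g zero    = zeroˡ (g 0)
  0-⋆ g (suc j) = ≈-trans (+-cong (zeroˡ (g (suc j))) (0-⋆ g j)) (+-identityˡ 0#)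

  one-⋆ : ∀ g → one ⋆ g ≐ g
  one-⋆ g zero    = *-identityˡ (g 0)
  one-⋆ g (suc j) = ≈-trans (+-cong (*-identityˡ (g (suc j))) (0-⋆ g j)) (+-identityʳ (g (suc j)))

  ⋆-linear : ∀ a f h g j → ((λ i → f i - a * h i) ⋆ g) j ≈ (f ⋆ g) j - a * (h ⋆ g) j
  ⋆-linear a f h g zero =
    solve 4 (λ a f h g → (f :- a :* h) :* g := f :* g :- a :* (h :* g)) ≈-refl a (f 0) (h 0) (g 0)
  ⋆-linear a f h g (suc j) = begin
    (f 0 - a * h 0) * g (suc j) + ((λ i → f (suc i) - a * h (suc i)) ⋆ g) j
      ≈⟨ +-congˡ (⋆-linear a (f ∘ suc) (h ∘ suc) g j) ⟩
    (f 0 - a * h 0) * g (suc j) + (((f ∘ suc) ⋆ g) j - a * ((h ∘ suc) ⋆ g) j)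
      ≈⟨ solve 6 (λ a f h g u v → (f :- a :* h) :* g :+ (u :- a :* v) := (f :* g :+ u) :- a :* (h :* g :+ v))
           ≈-refl a (f 0) (h 0) (g (suc j)) (((f ∘ suc) ⋆ g) j) (((h ∘ suc) ⋆ g) j) ⟩
    (f 0 * g (suc j) + ((f ∘ suc) ⋆ g) j) - a * (h 0 * g (suc j) + ((h ∘ suc) ⋆ g) j) ∎

  [1-X]-⋆ : ∀ a f g → ([1- a X]* f) ⋆ g ≐ [1- a X]* (f ⋆ g)
  [1-X]-⋆ a f g zero    = ≈-refl
  [1-X]-⋆ a f g (suc j) = begin
    f 0 * g (suc j) + ((λ i → f (suc i) - a * f i) ⋆ g) j
      ≈⟨ +-congˡ (⋆-linear a (f ∘ suc) f g j) ⟩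
    f 0 * g (suc j) + (((f ∘ suc) ⋆ g) j - a * (f ⋆ g) j)
      ≈⟨ +-assoc (f 0 * g (suc j)) (((f ∘ suc) ⋆ g) j) (- (a * (f ⋆ g) j)) ⟨
    (f 0 * g (suc j) + ((f ∘ suc) ⋆ g) j) - a * (f ⋆ g) j ∎

  ∏-++ : ∀ (r : I → Carrier) ks ls → ∏[1- r X] (ks ++ ls) ≐ ∏[1- r X] ks ⋆ ∏[1- r X] ls
  ∏-++ r []       ls j = ≈-sym (one-⋆ (∏[1- r X] ls) j)
  ∏-++ r (k ∷ ks) ls j = ≈-trans
    ([1-X]-cong ≈-refl (∏-++ r ks ls) j)
    (≈-sym ([1-X]-⋆ (r k) (∏[1- r X] ks) (∏[1- r X] ls) j))

  ⋆-integral : ∀ g j → (∀ i → Integral (f i)) → (∀ i → i ℕ.≤ j → Integral (g i)) → Integral ((f ⋆ g) j)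
  ⋆-integral g zero    fℤ gℤ = Integral-* (fℤ 0) (gℤ 0 ℕ.≤-refl)
  ⋆-integral g (suc j) fℤ gℤ = Integral-+ (Integral-* (fℤ 0) (gℤ (suc j) ℕ.≤-refl))
    (⋆-integral g j (fℤ ∘ suc) (λ i i≤j → gℤ i (ℕ.m≤n⇒m≤1+n i≤j)))

  -- Division by a monic polynomial, and the reason for reversing: the leading coefficient 1 becomes
  -- the constant term. Then `g (suc j)` is the coefficient of the product minus a combination of
  -- `g 0`, ..., `g j` with coefficients from `f`, so integrality propagates upwards by strong
  -- induction.
  ⋆-integral⁻ : f 0 ≈ 1# → (∀ i → Integral (f i)) → (∀ i → Integral ((f ⋆ g) i)) → ∀ j → Integral (g j)
  ⋆-integral⁻ {f} {g} f₀≈1 fℤ fgℤ j = upTo-integral j j ℕ.≤-refl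
    where
    upTo-integral : ∀ j i → i ℕ.≤ j → Integral (g i)
    upTo-integral zero zero _ = Integral-resp (≈-trans (*-congʳ f₀≈1) (*-identityˡ (g 0))) (fgℤ 0)
    upTo-integral (suc j) i i≤1+j with i ℕ.≟ suc j
    ... | no i≢1+j = upTo-integral j i (ℕ.s≤s⁻¹ (ℕ.≤∧≢⇒< i≤1+j i≢1+j))
    ... | yes ≡.refl = Integral-resp (begin
      (f 0 * g (suc j) + u) - u      ≈⟨ solve 2 (λ x u → (x :+ u) :- u := x) ≈-refl (f 0 * g (suc j)) u ⟩
      f 0 * g (suc j)                ≈⟨ *-congʳ f₀≈1 ⟩
      1# * g (suc j)                 ≈⟨ *-identityˡ (g (suc j)) ⟩
      g (suc j)                      ∎)
      (Integral-+ (fgℤ (suc j)) (Integral-neg (⋆-integral g j (fℤ ∘ suc) (upTo-integral j))))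
      where u = ((f ∘ suc) ⋆ g) j

  -- homogenize f m z = f₀ zᵐ + f₁ zᵐ⁻¹ + ⋯ + fₘ
  homogenize : (ℕ → Carrier) → ℕ → Carrier → Carrier
  homogenize f zero    z = f 0
  homogenize f (suc m) z = z * homogenize f m z + f (suc m)

  ∏[_-_] : Carrier → (I → Carrier) → List I → Carrier
  ∏[ z - r ] []       = 1#
  ∏[ z - r ] (k ∷ ks) = (z - r k) * ∏[ z - r ] ks

  ∏[-]-++ : ∀ (r : I → Carrier) z ks ls → ∏[ z - r ] (ks ++ ls) ≈ ∏[ z - r ] ks * ∏[ z - r ] ls
  ∏[-]-++ r z []       ls = ≈-sym (*-identityˡ _)
  ∏[-]-++ r z (k ∷ ks) ls = ≈-trans (*-congˡ (∏[-]-++ r z ks ls)) (≈-sym (*-assoc _ _ _))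

  homogenize-[1-X] : ∀ a f m z →
    homogenize ([1- a X]* f) (suc m) z ≈ homogenize f (suc m) z - a * homogenize f m z
  homogenize-[1-X] a f zero    z =
    solve 4 (λ a z f₀ f₁ → z :* f₀ :+ (f₁ :- a :* f₀) := (z :* f₀ :+ f₁) :- a :* f₀) ≈-refl a z (f 0) (f 1)
  homogenize-[1-X] a f (suc m) z = begin
    z * homogenize ([1- a X]* f) (suc m) z + (f (suc (suc m)) - a * f (suc m))
      ≈⟨ +-congʳ (*-congˡ (homogenize-[1-X] a f m z)) ⟩
    z * (homogenize f (suc m) z - a * homogenize f m z) + (f (suc (suc m)) - a * f (suc m))
      ≈⟨ solve 6 (λ a z f f′ h h′ → z :* (h′ :- a :* h) :+ (f′ :- a :* f) := (z :* h′ :+ f′) :- a :* (z :* h :+ f))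
           ≈-refl a z (f (suc m)) (f (suc (suc m))) (homogenize f m z) (homogenize f (suc m) z) ⟩
    homogenize f (suc (suc m)) z - a * homogenize f (suc m) z ∎

  -- Undoing the reversal turns each factor `1 - a X` into `z - a`. The degree goes up by one per
  -- factor; the extra coefficient `F (suc m)` this brings in lies beyond the degree of `F` and
  -- vanishes.
  homogenize-∏ : ∀ (r : I → Carrier) ks z → homogenize (∏[1- r X] ks) (length ks) z ≈ ∏[ z - r ] ks
  homogenize-∏ r []       z = ≈-refl
  homogenize-∏ r (k ∷ ks) z = begin
    homogenize ([1- r k X]* F) (suc m) z
      ≈⟨ homogenize-[1-X] (r k) F m z ⟩
    (z * homogenize F m z + F (suc m)) - r k * homogenize F m z
      ≈⟨ +-congʳ (+-congˡ (∏-degree r ks ℕ.≤-refl)) ⟩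
    (z * homogenize F m z + 0#) - r k * homogenize F m z
      ≈⟨ +-congʳ (+-identityʳ _) ⟩
    z * homogenize F m z - r k * homogenize F m z
      ≈⟨ solve 3 (λ z a h → z :* h :- a :* h := (z :- a) :* h) ≈-refl z (r k) (homogenize F m z) ⟩
    (z - r k) * homogenize F m z
      ≈⟨ *-congˡ (homogenize-∏ r ks z) ⟩
    (z - r k) * ∏[ z - r ] ks ∎
    where
    F = ∏[1- r X] ks
    m = length ks

  -- Vanishing is asked only up to `m`: with `m = d′` this covers the series `P` of a root of order
  -- `suc d′`, all but its last coefficient.
  homogenize-sparse : ∀ m → f 0 ≈ 1# → (∀ j → 0 ℕ.< j → j ℕ.≤ m → f j ≈ 0#) → ∀ z → homogenize f m z ≈ z ^ m
  homogenize-sparse zero    f₀≈1 f≈0 z = f₀≈1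
  homogenize-sparse (suc m) f₀≈1 f≈0 z = ≈-trans
    (+-cong (*-congˡ (homogenize-sparse m f₀≈1 (λ j 0<j j≤m → f≈0 j 0<j (ℕ.m≤n⇒m≤1+n j≤m)) z))
            (f≈0 (suc m) ℕ.z<s ℕ.≤-refl))
    (+-identityʳ (z ^ suc m))

  1^n≈1 : ∀ n → 1# ^ n ≈ 1#
  1^n≈1 zero    = ≈-refl
  1^n≈1 (suc n) = ≈-trans (*-identityˡ (1# ^ n)) (1^n≈1 n)

  -- For η of exact order d, the product P of 1 − ηᵏX over k = 1, …, d is 1 − Xᵈ:
  -- replacing X by ηX only rotates the factors, so (ηʲ − 1)Pⱼ = 0, and P vanishes at 1.
  module RootsOfUnity (η : Carrier) (d′ : ℕ) (ηᵈ≈1 : η ^ suc d′ ≈ 1#)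
    (order : ∀ j → 0 ℕ.< j → j ℕ.< suc d′ → Regular (η ^ j - 1#)) where

    private
      d : ℕ
      d = suc d′

    P : ℕ → Carrier
    P = ∏[1- η ^_ X] (range d)

    rotate : P ≐ ∏[1- η ^_ X] (upTo d)
    rotate j = begin
      ∏[1- η ^_ X] (range d) j
        ≡⟨ ≡.cong (λ ks → ∏[1- η ^_ X] ks j) (range-∷ʳ d′) ⟩
      ∏[1- η ^_ X] (range d′ ++ d ∷ []) j
        ≈⟨ ∏-↭ (η ^_) (↭-sym (∷↭∷ʳ d (range d′))) j ⟩
      ([1- η ^ d X]* (∏[1- η ^_ X] (range d′))) j
        ≈⟨ [1-X]-cong ηᵈ≈1 (λ _ → ≈-refl) j ⟩
      ([1- η ^ 0 X]* (∏[1- η ^_ X] (range d′))) j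
        ≡⟨ ≡.cong (λ ks → ∏[1- η ^_ X] (0 ∷ ks) j) (List.map-upTo suc d′) ⟩
      ∏[1- η ^_ X] (upTo d) j ∎

    P-eigen : ∀ j → P j ≈ η ^ j * P j
    P-eigen j = begin
      P j                                            ≈⟨ ∏-map (η ^_) suc (upTo d) j ⟩
      ∏[1- (λ k → η * η ^ k) X] (upTo d) j           ≈⟨ ∏-scale η (η ^_) (upTo d) j ⟩
      η ^ j * ∏[1- η ^_ X] (upTo d) j                ≈⟨ *-congˡ (rotate j) ⟨
      η ^ j * P j                                    ∎

    P-middle : ∀ j → 0 ℕ.< j → j ℕ.< d → P j ≈ 0#
    P-middle j 0<j j<d = order j 0<j j<d (P j) (begin
      (η ^ j - 1#) * P j          ≈⟨ solve 3 (λ x o p → (x :- o) :* p := x :* p :- o :* p) ≈-refl (η ^ j) 1# (P j) ⟩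
      η ^ j * P j - 1# * P j      ≈⟨ +-cong (≈-sym (P-eigen j)) (-‿cong (*-identityˡ (P j))) ⟩
      P j - P j                   ≈⟨ -‿inverseʳ (P j) ⟩
      0#                          ∎)

    homogenize-P : ∀ z → homogenize P d z ≈ z ^ d + P d
    homogenize-P z = +-congʳ (*-congˡ (homogenize-sparse d′ (∏-constant (η ^_) (range d))
      (λ j 0<j j≤d′ → P-middle j 0<j (ℕ.s≤s j≤d′)) z))

    evaluate : ∀ z → ∏[ z - η ^_ ] (range d) ≈ z ^ d + P d
    evaluate z = begin
      ∏[ z - η ^_ ] (range d)                ≈⟨ homogenize-∏ (η ^_) (range d) z ⟨
      homogenize P (length (range d)) z      ≡⟨ ≡.cong (λ m → homogenize P m z) (length-range d) ⟩
      homogenize P d z                       ≈⟨ homogenize-P z ⟩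
      z ^ d + P d                            ∎

    P-last : P d ≈ - 1#
    P-last = begin
      P d                                                        ≈⟨ solve 2 (λ o p → p := (o :+ p) :- o) ≈-refl 1# (P d) ⟩
      (1# + P d) - 1#                                            ≈⟨ +-congʳ (+-congʳ (1^n≈1 d)) ⟨
      (1# ^ d + P d) - 1#                                        ≈⟨ +-congʳ (evaluate 1#) ⟨
      ∏[ 1# - η ^_ ] (range d) - 1#                              ≡⟨ ≡.cong (λ ks → ∏[ 1# - η ^_ ] ks - 1#) (range-∷ʳ d′) ⟩
      ∏[ 1# - η ^_ ] (range d′ ++ d ∷ []) - 1#                   ≈⟨ +-congʳ (∏[-]-++ (η ^_) 1# (range d′) (d ∷ [])) ⟩
      ∏[ 1# - η ^_ ] (range d′) * ((1# - η ^ d) * 1#) - 1#       ≈⟨ +-congʳ (*-congˡ (*-congʳ (a≈b⇒a-b≈0 (≈-sym ηᵈ≈1)))) ⟩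
      ∏[ 1# - η ^_ ] (range d′) * (0# * 1#) - 1#                 ≈⟨ +-congʳ (≈-trans (*-congˡ (zeroˡ 1#)) (zeroʳ _)) ⟩
      0# - 1#                                                    ≈⟨ +-identityˡ (- 1#) ⟩
      - 1#                                                       ∎

    P-integral : ∀ j → Integral (P j)
    P-integral zero = Integral-resp (≈-sym (∏-constant (η ^_) (range d))) Integral-1
    P-integral j@(suc _) with ℕ.<-cmp j d
    ... | tri< j<d _ _ = Integral-resp (≈-sym (P-middle j ℕ.z<s j<d)) Integral-0
    ... | tri≈ _ ≡.refl _ = Integral-resp (≈-sym P-last) (Integral-neg Integral-1)
    ... | tri> _ _ d<j = Integral-resp
      (≈-sym (∏-degree (η ^_) (range d) (≡.subst (ℕ._< j) (≡.sym (length-range d)) d<j))) Integral-0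

    ∏≈zᵈ-1 : ∀ z → ∏[ z - η ^_ ] (range d) ≈ z ^ d - 1#
    ∏≈zᵈ-1 z = ≈-trans (evaluate z) (+-congˡ P-last)

  ∏[-]-↭ : {I : Set} (r : I → Carrier) → ∀ z {ks ls} → ks ↭ ls → ∏[ z - r ] ks ≈ ∏[ z - r ] ls
  ∏[-]-↭ r z refl = ≈-refl
  ∏[-]-↭ r z (prep k p) = *-congˡ (∏[-]-↭ r z p)
  ∏[-]-↭ r z (swap k l p) = ≈-trans (*-congˡ (*-congˡ (∏[-]-↭ r z p)))
    (solve 3 (λ x y u → x :* (y :* u) := y :* (x :* u)) ≈-refl (z - r k) (z - r l) _)
  ∏[-]-↭ r z (trans p q) = ≈-trans (∏[-]-↭ r z p) (∏[-]-↭ r z q)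

  Regular-∏ : {I : Set} (r : I → Carrier) → ∀ z {ks} → All (λ k → Regular (z - r k)) ks → Regular (∏[ z - r ] ks)
  Regular-∏ r z [] w 1w≈0 = ≈-trans (≈-sym (*-identityˡ w)) 1w≈0
  Regular-∏ r z (reg ∷ regs) w xyw≈0 =
    Regular-∏ r z regs w (reg _ (≈-trans (≈-sym (*-assoc _ _ w)) xyw≈0))

  -- The multiplier `w` is carried along because regularity is tested on a `w` with
  -- `(a - b) * w ≈ 0#`; in that situation `a` and `b` agree only after multiplication by `w`.
  ^-eigen : ∀ {a b w} → a * w ≈ b * w → ∀ m → a ^ m * w ≈ b ^ m * w
  ^-eigen aw≈bw zero = ≈-refl
  ^-eigen {a} {b} {w} aw≈bw (suc m) = begin
    a * a ^ m * w      ≈⟨ *-assoc a (a ^ m) w ⟩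
    a * (a ^ m * w)    ≈⟨ *-congˡ (^-eigen aw≈bw m) ⟩
    a * (b ^ m * w)    ≈⟨ solve 3 (λ a b w → a :* (b :* w) := b :* (a :* w)) ≈-refl a (b ^ m) w ⟩
    b ^ m * (a * w)    ≈⟨ *-congˡ aw≈bw ⟩
    b ^ m * (b * w)    ≈⟨ solve 3 (λ b bᵐ w → bᵐ :* (b :* w) := b :* bᵐ :* w) ≈-refl b (b ^ m) w ⟩
    b * b ^ m * w      ∎

  -- `IsPrimitiveRoot` with the inequations strengthened to regularity, which keeps its force in a
  -- ring with zero divisors.
  Primitive : ℕ → Carrier → Set _
  Primitive n z = z ^ n ≈ 1# × (∀ j → 0 ℕ.< j → j ℕ.< n → Regular (z ^ j - 1#))

  -- The sieve by gcd classes and the cyclotomic polynomial.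

  module Sieve (n : ℕ) .{{_ : NonZero n}} (ω : Carrier) (ω-primitive : Primitive n ω) where

    IntegralProduct : List ℕ → Set _
    IntegralProduct ks = ∀ j → Integral (∏[1- ω ^_ X] ks j)

    -- The one operation of the sieve: the product over `ms` is divided by the product over `ks`,
    -- whose constant term is 1.
    IntegralProduct-cancel : ∀ ks ls {ms} → ms ↭ ks ++ ls →
      IntegralProduct ks → IntegralProduct ms → IntegralProduct ls
    IntegralProduct-cancel ks ls ms↭ ksℤ msℤ = ⋆-integral⁻ (∏-constant (ω ^_) ks) ksℤ λ j →
      Integral-resp (≈-trans (∏-↭ (ω ^_) ms↭ j) (∏-++ (ω ^_) ks ls j)) (msℤ j)

    power-primitive : ∀ g d → .{{NonZero g}} → n ≡ g ℕ.* d → Primitive d (ω ^ g)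
    power-primitive g d n≡gd =
      ≈-trans (≈-trans (^-assocʳ ω g d) (^-congʳ ω (≡.sym n≡gd))) (proj₁ ω-primitive) ,
      λ j 0<j j<d w eq → proj₂ ω-primitive (g ℕ.* j)
        (≡.subst (ℕ._< g ℕ.* j) (ℕ.*-zeroʳ g) (ℕ.*-monoʳ-< g 0<j))
        (≡.subst (g ℕ.* j ℕ.<_) (≡.sym n≡gd) (ℕ.*-monoʳ-< g j<d))
        w (≈-trans (*-congʳ (+-congʳ (≈-sym (^-assocʳ ω g j)))) eq)

    range-integral : ∀ d η → .{{NonZero d}} → Primitive d η → ∀ j → Integral (∏[1- η ^_ X] (range d) j)
    range-integral (suc d′) η (ηᵈ≈1 , order) = RootsOfUnity.P-integral η d′ ηᵈ≈1 order

    withGcd : ℕ → List ℕ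
    withGcd g = filter (λ k → gcd k n ℕ.≟ g) (range n)

    multiples : ℕ → List ℕ
    multiples g = filter (g ∣?_) (range n)

    multiples-integral : ∀ g → g ∣ n → IntegralProduct (multiples g)
    multiples-integral g (divides d n≡dg) j = Integral-resp (begin
      ∏[1- (ω ^ g) ^_ X] (range d) j             ≈⟨ ∏-cong (^-assocʳ ω g) (range d) j ⟩
      ∏[1- (λ k → ω ^ (g ℕ.* k)) X] (range d) j  ≈⟨ ∏-map (ω ^_) (g ℕ.*_) (range d) j ⟨
      ∏[1- ω ^_ X] (map (g ℕ.*_) (range d)) j    ≈⟨ ∏-↭ (ω ^_) (multiples-↭ g d) j ⟨
      ∏[1- ω ^_ X] (filter (g ∣?_) (range (g ℕ.* d))) j
        ≡⟨ ≡.cong (λ N → ∏[1- ω ^_ X] (filter (g ∣?_) (range N)) j) n≡gd ⟨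
      ∏[1- ω ^_ X] (multiples g) j               ∎)
      (range-integral d (ω ^ g) (power-primitive g d n≡gd) j)
      where
      n≡gd : n ≡ g ℕ.* d
      n≡gd = ≡.trans n≡dg (ℕ.*-comm d g)
      instance
        gd-nonZero : NonZero (g ℕ.* d)
        gd-nonZero = ≡.subst NonZero n≡gd (ℕ.≢-nonZero (ℕ.≢-nonZero⁻¹ n))
        g-nonZero : NonZero g
        g-nonZero = ℕ.m*n≢0⇒m≢0 g {d}
        d-nonZero : NonZero d
        d-nonZero = ℕ.m*n≢0⇒n≢0 g {d}

    gcd≤n : ∀ k → gcd k n ℕ.≤ n
    gcd≤n k = ∣⇒≤ (gcd[m,n]∣n k n)

    []-integral : IntegralProduct []
    []-integral zero    = Integral-1
    []-integral (suc _) = Integral-0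

    module _ (g : ℕ) (g∣n : g ∣ n)
      (larger : ∀ h → g ℕ.< h → h ∣ n → IntegralProduct (withGcd h)) where

      -- Interpolates between `multiples g`, reached for `b ≥ n`, and `withGcd g`, reached at
      -- `b = g`. Lowering the bound from `suc b` to `b` removes exactly the class of gcd `suc b`.
      atMost : ℕ → List ℕ
      atMost b = filter (λ k → g ∣? k ×-dec gcd k n ℕ.≤? b) (range n)

      exactly : ℕ → List ℕ
      exactly b = filter (λ k → g ∣? k ×-dec gcd k n ℕ.≟ b) (range n)

      -- As `g` divides both `k` and `n`, it is at most their gcd, so the upper bound `g` forces
      -- equality.
      atMost≡withGcd : atMost g ≡ withGcd g
      atMost≡withGcd = List.filter-≐ _ _
        ( (λ {k} (g∣k , gcd≤g) → ℕ.≤-antisym gcd≤g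
            (∣⇒≤ {{ℕ.≢-nonZero (gcd[m,n]≢0 k n (inj₂ (ℕ.≢-nonZero⁻¹ n)))}} (gcd-greatest g∣k g∣n)))
        , (λ {k} gcd≡g → ≡.subst (_∣ k) gcd≡g (gcd[m,n]∣m k n) , ℕ.≤-reflexive gcd≡g))
        (range n)

      atMost≡multiples : ∀ b → n ℕ.≤ b → atMost b ≡ multiples g
      atMost≡multiples b n≤b =
        List.filter-≐ _ _ (proj₁ , λ {k} g∣k → g∣k , ℕ.≤-trans (gcd≤n k) n≤b) (range n)

      atMost-suc : ∀ b → atMost (suc b) ↭ exactly (suc b) ++ atMost b
      atMost-suc b = filter-⊎-↭ _ _ _
        (λ (g∣k , gcd≤) → Sum.map (g∣k ,_) (λ gcd< → g∣k , ℕ.s≤s⁻¹ gcd<)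
          (Sum.swap (ℕ.m≤n⇒m<n∨m≡n gcd≤)))
        (λ (g∣k , gcd≡) → g∣k , ℕ.≤-reflexive gcd≡)
        (λ (g∣k , gcd≤b) → g∣k , ℕ.m≤n⇒m≤1+n gcd≤b)
        (λ (_ , gcd≡) (_ , gcd≤b) → ℕ.1+n≰n (≡.subst (ℕ._≤ b) gcd≡ gcd≤b))
        (range n)

      -- The gcd of `k` and `n` divides `n`, and is divisible by `g` when `k` is. So the list is
      -- empty unless `g ∣ h` and `h ∣ n`, and in that case the condition `g ∣ k` is automatic and
      -- `larger` applies.
      exactly-integral : ∀ h → g ℕ.< h → IntegralProduct (exactly h)
      exactly-integral h g<h with g ∣? h | h ∣? n
      ... | yes g∣h | yes h∣n = ≡.subst IntegralProduct
        (List.filter-≐ _ _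
          ((λ {k} gcd≡h → ∣-trans g∣h (≡.subst (_∣ k) gcd≡h (gcd[m,n]∣m k n)) , gcd≡h) , proj₂)
          (range n))
        (larger h g<h h∣n)
      ... | no g∤h | _ = ≡.subst IntegralProduct
        (≡.sym (List.filter-none _ (All.universal
          (λ k (g∣k , gcd≡h) → g∤h (≡.subst (g ∣_) gcd≡h (gcd-greatest g∣k g∣n))) (range n))))
        []-integral
      ... | yes _ | no h∤n = ≡.subst IntegralProduct
        (≡.sym (List.filter-none _ (All.universal
          (λ k (_ , gcd≡h) → h∤n (≡.subst (_∣ n) gcd≡h (gcd[m,n]∣n k n))) (range n))))
        []-integral

      -- `steps` bounds the distance from `b` up to `n`: the recursion raises the bound until it
      -- admits all multiples of `g`, and divides out one class on each step back.
      atMost-integral : ∀ steps b → n ℕ.≤ steps ℕ.+ b → g ℕ.≤ b → IntegralProduct (atMost b)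
      atMost-integral zero b n≤b _ =
        ≡.subst IntegralProduct (≡.sym (atMost≡multiples b n≤b)) (multiples-integral g g∣n)
      atMost-integral (suc steps) b n≤1+steps+b g≤b =
        IntegralProduct-cancel (exactly (suc b)) (atMost b) (atMost-suc b)
          (exactly-integral (suc b) (ℕ.s≤s g≤b))
          (atMost-integral steps (suc b) (≡.subst (n ℕ.≤_) (≡.sym (ℕ.+-suc steps b)) n≤1+steps+b)
            (ℕ.m≤n⇒m≤1+n g≤b))

      withGcd-integral-step : IntegralProduct (withGcd g)
      withGcd-integral-step =
        ≡.subst IntegralProduct atMost≡withGcd (atMost-integral n g (ℕ.m≤m+n n g) ℕ.≤-refl)

    withGcd-integral : ∀ g → g ∣ n → IntegralProduct (withGcd g)
    withGcd-integral g g∣n = descend n g g∣n (ℕ.m≤m+n n g)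
      where
      -- `fuel` bounds `n - g`, and any larger divisor `h` leaves less of it. At `fuel = 0` there is
      -- no divisor of `n` above `g`.
      descend : ∀ fuel g → g ∣ n → n ℕ.≤ fuel ℕ.+ g → IntegralProduct (withGcd g)
      descend zero g g∣n n≤g = withGcd-integral-step g g∣n λ h g<h h∣n →
        contradiction (ℕ.≤-<-trans n≤g g<h) (ℕ.≤⇒≯ (∣⇒≤ h∣n))
      descend (suc fuel) g g∣n n≤1+fuel+g = withGcd-integral-step g g∣n λ h g<h h∣n →
        descend fuel h h∣n (ℕ.≤-trans n≤1+fuel+g
          (ℕ.≤-trans (ℕ.≤-reflexive (≡.sym (ℕ.+-suc fuel g))) (ℕ.+-monoʳ-≤ fuel g<h)))

    coprimes : List ℕ
    coprimes = filter (λ k → coprime? k n) (range n)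

    coprimes≡withGcd-1 : coprimes ≡ withGcd 1
    coprimes≡withGcd-1 = List.filter-≐ _ _ (coprime⇒gcd≡1 , gcd≡1⇒coprime) (range n)

    cyclotomic : ℕ → Carrier
    cyclotomic = ∏[1- ω ^_ X] coprimes

    cyclotomic-integral : ∀ j → Integral (cyclotomic j)
    cyclotomic-integral = ≡.subst IntegralProduct (≡.sym coprimes≡withGcd-1) (withGcd-integral 1 (1∣ n))

    -- At `z` the product over all of `range n` equals `z ^ n - 1#`, which vanishes. The factors
    -- with `k` not coprime to `n` are regular, since `ω ^ k` has order less than `n`; cancelling
    -- them leaves the coprime ones.
    root-coprime : ∀ z → Primitive n z → ∏[ z - ω ^_ ] coprimes ≈ 0#
    root-coprime z (zⁿ≈1 , order) = Regular-∏ (ω ^_) z others-regular (∏[ z - ω ^_ ] coprimes) (begin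
      ∏[ z - ω ^_ ] others * ∏[ z - ω ^_ ] coprimes   ≈⟨ ∏[-]-++ (ω ^_) z others coprimes ⟨
      ∏[ z - ω ^_ ] (others ++ coprimes)              ≈⟨ ∏[-]-↭ (ω ^_) z split ⟨
      ∏[ z - ω ^_ ] (range n)                         ≈⟨ vanishes n ω ω-primitive zⁿ≈1 ⟩
      0#                                              ∎)
      where
      others : List ℕ
      others = filter (λ k → ¬? (coprime? k n)) (range n)

      split : range n ↭ others ++ coprimes
      -- `range n` is read as its own filter by the universal predicate, the form that `filter-⊎-↭`
      -- splits.
      split = ↭-trans (↭-reflexive (≡.sym (List.filter-all U? (All.universal (λ _ → tt) (range n)))))
        (filter-⊎-↭ (λ k → ¬? (coprime? k n)) (λ k → coprime? k n) U?
          (λ {k} _ → Sum.swap (toSum (coprime? k n))) (λ _ → tt) (λ _ → tt) id (range n))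

      vanishes : ∀ d η → .{{NonZero d}} → Primitive d η → z ^ d ≈ 1# → ∏[ z - η ^_ ] (range d) ≈ 0#
      vanishes (suc d′) η (ηᵈ≈1 , η-order) zᵈ≈1 =
        ≈-trans (RootsOfUnity.∏≈zᵈ-1 η d′ ηᵈ≈1 η-order z) (a≈b⇒a-b≈0 zᵈ≈1)

      -- If z w = ωᵏ w then (z^(n/g) − 1) w = 0, where g = gcd k n.
      regular : ∀ k → ¬ Coprime k n → Regular (z - ω ^ k)
      regular k not-coprime w [z-ωᵏ]w≈0 with gcd[m,n]∣m k n | gcd[m,n]∣n k n
      ... | divides e k≡eh | divides d n≡dh = order d 0<d d<n w (begin
        (z ^ d - 1#) * w              ≈⟨ solve 3 (λ x o w → (x :- o) :* w := x :* w :- o :* w) ≈-refl (z ^ d) 1# w ⟩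
        z ^ d * w - 1# * w            ≈⟨ +-congʳ (^-eigen zw≈ωᵏw d) ⟩
        (ω ^ k) ^ d * w - 1# * w      ≈⟨ a≈b⇒a-b≈0 (*-congʳ ωᵏᵈ≈1) ⟩
        0#                            ∎)
        where
        h : ℕ
        h = gcd k n
        instance
          dh-nonZero : NonZero (d ℕ.* h)
          dh-nonZero = ≡.subst NonZero n≡dh (ℕ.≢-nonZero (ℕ.≢-nonZero⁻¹ n))
          d-nonZero : NonZero d
          d-nonZero = ℕ.m*n≢0⇒m≢0 d {h}
          h-nonZero : NonZero h
          h-nonZero = ℕ.m*n≢0⇒n≢0 d {h}

        0<d : 0 ℕ.< d
        0<d = ℕ.>-nonZero⁻¹ d

        d<n : d ℕ.< n
        d<n = ≡.subst (d ℕ.<_) (≡.sym n≡dh) (ℕ.m<m*n d h (ℕ.≤∧≢⇒< (ℕ.>-nonZero⁻¹ h)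
          (λ 1≡h → not-coprime (gcd≡1⇒coprime (≡.sym 1≡h)))))

        zw≈ωᵏw : z * w ≈ ω ^ k * w
        zw≈ωᵏw = a-b≈0⇒a≈b (≈-trans
          (solve 3 (λ z x w → z :* w :- x :* w := (z :- x) :* w) ≈-refl z (ω ^ k) w) [z-ωᵏ]w≈0)

        ωᵏᵈ≈1 : (ω ^ k) ^ d ≈ 1#
        ωᵏᵈ≈1 = begin
          (ω ^ k) ^ d        ≈⟨ ^-assocʳ ω k d ⟩
          ω ^ (k ℕ.* d)      ≡⟨ ≡.cong (ω ^_) kd≡ne ⟩
          ω ^ (n ℕ.* e)      ≈⟨ ^-assocʳ ω n e ⟨
          (ω ^ n) ^ e        ≈⟨ ^-congˡ e (proj₁ ω-primitive) ⟩
          1# ^ e             ≈⟨ 1^n≈1 e ⟩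
          1#                 ∎
          where
          kd≡ne : k ℕ.* d ≡ n ℕ.* e
          kd≡ne = ≡.trans (≡.cong (ℕ._* d) k≡eh) (≡.trans
            (ℕ-Solver.solve 3 (λ e h d → e ℕ-Solver.:* h ℕ-Solver.:* d ℕ-Solver.:= d ℕ-Solver.:* h ℕ-Solver.:* e) ≡.refl e h d)
            (≡.cong (ℕ._* e) (≡.sym n≡dh)))

      others-regular : All (λ k → Regular (z - ω ^ k)) others
      others-regular = All.map (regular _) (all-filter (λ k → ¬? (coprime? k n)) (range n))

    cyclotomic-root : ∀ z → Primitive n z → homogenize cyclotomic (length coprimes) z ≈ 0#
    cyclotomic-root z z-primitive = ≈-trans (homogenize-∏ (ω ^_) coprimes z) (root-coprime z z-primitive)

  -- Polynomials as coefficient vectors: reduction of powers, division and uniqueness.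

  sum-1 : ∀ n → sum {n} (λ _ → 1#) ≈ ⟦ + n ⟧
  sum-1 zero    = ≈-sym 0-homo
  sum-1 (suc n) = ≈-trans (+-cong (≈-sym 1-homo) (sum-1 n)) (≈-sym (+-homo (+ 1) (+ n)))

  eval : ∀ {m} → Vector Carrier m → Carrier → Carrier
  eval c x = sum (λ j → c j * x ^ toℕ j)

  eval-suc : ∀ {m} (c : Vector Carrier (suc m)) x → eval c x ≈ head c + x * eval (tail c) x
  eval-suc c x = +-cong (*-identityʳ (head c)) (begin
    sum (λ j → tail c j * (x * x ^ toℕ j))
      ≈⟨ sum-cong-≋ (λ j → solve 3 (λ c x xʲ → c :* (x :* xʲ) := x :* (c :* xʲ)) ≈-refl (tail c j) x (x ^ toℕ j)) ⟩
    sum (λ j → x * (tail c j * x ^ toℕ j))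
      ≈⟨ *-distribˡ-sum x (λ j → tail c j * x ^ toℕ j) ⟨
    x * eval (tail c) x ∎)

  eval-0 : ∀ {m} (c : Vector Carrier m) x → (∀ j → c j ≈ 0#) → eval c x ≈ 0#
  eval-0 {m} c x c≈0 = begin
    eval c x                               ≈⟨ sum-cong-≋ {m} (λ j → *-congʳ (c≈0 j)) ⟩
    sum {m} (λ j → 0# * x ^ toℕ j)         ≈⟨ *-distribˡ-sum {m} 0# (λ j → x ^ toℕ j) ⟨
    0# * sum {m} (λ j → x ^ toℕ j)         ≈⟨ zeroˡ _ ⟩
    0#                                     ∎

  -- The combination `b - a * c` is the one formed by a reduction step in `power-reduction`; with
  -- `a = 1#` it serves for differences of columns.
  eval-linear : ∀ {m} a (b c : Vector Carrier m) x → eval (λ j → b j - a * c j) x ≈ eval b x - a * eval c x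
  eval-linear {zero}  a b c x = ≈-sym (a-b*0≈a 0# a)
  eval-linear {suc m} a b c x = begin
    eval (λ j → b j - a * c j) x
      ≈⟨ eval-suc (λ j → b j - a * c j) x ⟩
    (head b - a * head c) + x * eval (λ j → tail b j - a * tail c j) x
      ≈⟨ +-congˡ (*-congˡ (eval-linear a (tail b) (tail c) x)) ⟩
    (head b - a * head c) + x * (eval (tail b) x - a * eval (tail c) x)
      ≈⟨ solve 6 (λ a x b c u v → (b :- a :* c) :+ x :* (u :- a :* v) := (b :+ x :* u) :- a :* (c :+ x :* v))
           ≈-refl a x (head b) (head c) (eval (tail b) x) (eval (tail c) x) ⟩
    (head b + x * eval (tail b) x) - a * (head c + x * eval (tail c) x)
      ≈⟨ +-cong (eval-suc b x) (-‿cong (*-congˡ (eval-suc c x))) ⟨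
    eval b x - a * eval c x ∎

  geometric : ∀ n x → (x - 1#) * sum {n} (λ k → x ^ toℕ k) ≈ x ^ n - 1#
  geometric zero    x = ≈-trans (zeroʳ (x - 1#)) (≈-sym (-‿inverseʳ 1#))
  geometric (suc n) x = begin
    (x - 1#) * (1# + sum {n} (λ k → x * x ^ toℕ k))
      ≈⟨ *-congˡ (+-congˡ (≈-sym (*-distribˡ-sum {n} x (λ k → x ^ toℕ k)))) ⟩
    (x - 1#) * (1# + x * S)
      ≈⟨ solve 3 (λ x o s → (x :- o) :* (o :+ x :* s) := (x :- o) :* o :+ x :* ((x :- o) :* s)) ≈-refl x 1# S ⟩
    (x - 1#) * 1# + x * ((x - 1#) * S)
      ≈⟨ +-cong (*-identityʳ (x - 1#)) (*-congˡ (geometric n x)) ⟩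
    (x - 1#) + x * (x ^ n - 1#)
      ≈⟨ solve 3 (λ x xⁿ o → (x :- o) :+ x :* (xⁿ :- o) := (x :* xⁿ :- o) :+ (x :- x :* o)) ≈-refl x (x ^ n) 1# ⟩
    (x * x ^ n - 1#) + (x - x * 1#)
      ≈⟨ +-congˡ (a≈b⇒a-b≈0 (≈-sym (*-identityʳ x))) ⟩
    (x * x ^ n - 1#) + 0#
      ≈⟨ +-identityʳ _ ⟩
    x * x ^ n - 1# ∎
    where S = sum {n} (λ k → x ^ toℕ k)

  -- `homogenize` is Horner's scheme, from the leading coefficient down. Each step multiplies by `z`
  -- and adds a new constant term, so `a` grows at the front and lists the coefficients from the
  -- lowest degree.
  homogenize-monic : ∀ f → f 0 ≈ 1# → (∀ j → Integral (f j)) → ∀ m →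
    ∃[ a ] ((∀ j → Integral (a j)) × (∀ z → homogenize f m z ≈ z ^ m + eval {m} a z))
  homogenize-monic f f₀≈1 fℤ zero = (λ ()) , (λ ()) , λ z → ≈-trans f₀≈1 (≈-sym (+-identityʳ 1#))
  homogenize-monic f f₀≈1 fℤ (suc m) with homogenize-monic f f₀≈1 fℤ m
  ... | a , aℤ , h≈ = f (suc m) Vec.∷ a , (λ { zero → fℤ (suc m) ; (suc j) → aℤ j }) , λ z → begin
    z * homogenize f m z + f (suc m)          ≈⟨ +-congʳ (*-congˡ (h≈ z)) ⟩
    z * (z ^ m + eval a z) + f (suc m)        ≈⟨ solve 4 (λ z zᵐ e f → z :* (zᵐ :+ e) :+ f := z :* zᵐ :+ (f :+ z :* e)) ≈-refl z (z ^ m) (eval a z) (f (suc m)) ⟩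
    z * z ^ m + (f (suc m) + z * eval a z)    ≈⟨ +-congˡ (eval-suc (f (suc m) Vec.∷ a) z) ⟨
    z * z ^ m + eval (f (suc m) Vec.∷ a) z        ∎

  -- Multiplication by `z` shifts the coefficients and pushes the term `last b * z ^ suc m` out of
  -- range; at a root this term equals `- (last b * eval a z)` and folds back. The vector `b` is
  -- chosen before `z`, so one integer vector serves all the roots and can be a column of a matrix.
  power-reduction : ∀ {m} (a : Vector Carrier (suc m)) → (∀ j → Integral (a j)) → ∀ k →
    ∃[ b ] ((∀ j → Integral (b j)) × (∀ z → z ^ suc m + eval a z ≈ 0# → z ^ k ≈ eval {suc m} b z))
  power-reduction {m} a aℤ zero = 1# Vec.∷ (λ _ → 0#) , (λ { zero → Integral-1 ; (suc _) → Integral-0 }) , λ z _ → begin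
    1#                                          ≈⟨ +-identityʳ 1# ⟨
    1# + 0#                                     ≈⟨ +-congˡ (≈-trans (*-congˡ (eval-0 {m} (λ _ → 0#) z (λ _ → ≈-refl))) (zeroʳ z)) ⟨
    1# + z * eval {m} (λ _ → 0#) z              ≈⟨ eval-suc {m} (1# Vec.∷ (λ _ → 0#)) z ⟨
    eval {suc m} (1# Vec.∷ (λ _ → 0#)) z            ∎
  power-reduction {m} a aℤ (suc k) with power-reduction a aℤ k
  ... | b , bℤ , zᵏ≈ = (λ j → shifted j - last b * a j) , integral , reduce
    where
    shifted : Vector Carrier (suc m)
    shifted = 0# Vec.∷ init b

    shifted-integral : ∀ j → Integral (shifted j)
    shifted-integral zero    = Integral-0
    shifted-integral (suc j) = bℤ (inject₁ j)

    integral : ∀ j → Integral (shifted j - last b * a j)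
    integral j = Integral-+ (shifted-integral j) (Integral-neg (Integral-* (bℤ (fromℕ m)) (aℤ j)))

    eval-init-last : ∀ z → eval b z ≈ eval (init b) z + last b * z ^ m
    eval-init-last z = ≈-trans (sum-init-last (λ j → b j * z ^ toℕ j)) (+-cong
      (sum-cong-≋ {m} (λ j → *-congˡ (^-congʳ z (Fin.toℕ-inject₁ j))))
      (*-congˡ (^-congʳ z (Fin.toℕ-fromℕ m))))

    reduce : ∀ z → z ^ suc m + eval a z ≈ 0# → z ^ suc k ≈ eval (λ j → shifted j - last b * a j) z
    reduce z root = begin
      z * z ^ k
        ≈⟨ *-congˡ (≈-trans (zᵏ≈ z root) (eval-init-last z)) ⟩
      z * (eval (init b) z + last b * z ^ m)
        -- `last b * eval a z` is subtracted and added back, which brings out the vanishing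
        -- `z ^ suc m + eval a z`.
        ≈⟨ solve 5 (λ z e l zᵐ ea → z :* (e :+ l :* zᵐ) := (z :* e :- l :* ea) :+ l :* (z :* zᵐ :+ ea))
             ≈-refl z (eval (init b) z) (last b) (z ^ m) (eval a z) ⟩
      (z * eval (init b) z - last b * eval a z) + last b * (z ^ suc m + eval a z)
        ≈⟨ +-congˡ (≈-trans (*-congˡ root) (zeroʳ (last b))) ⟩
      (z * eval (init b) z - last b * eval a z) + 0#
        ≈⟨ +-identityʳ _ ⟩
      z * eval (init b) z - last b * eval a z
        ≈⟨ +-congʳ (≈-trans (eval-suc shifted z) (+-identityˡ _)) ⟨
      eval shifted z - last b * eval a z
        ≈⟨ eval-linear (last b) shifted a z ⟨
      eval (λ j → shifted j - last b * a j) z ∎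

  -- Synthetic division by `x - x₀`: the coefficient of degree `j` is the value at `x₀` of what
  -- remains of `c` after dropping its first `j + 1` entries.
  quotient : ∀ {m} → Carrier → Vector Carrier (suc m) → Vector Carrier m
  quotient x₀ c zero    = eval (tail c) x₀
  quotient x₀ c (suc j) = quotient x₀ (tail c) j

  eval-quotient : ∀ {m} (c : Vector Carrier (suc m)) x₀ x →
    eval c x ≈ eval c x₀ + (x - x₀) * eval (quotient x₀ c) x
  eval-quotient {zero} c x₀ x = begin
    eval c x                     ≈⟨ +-identityʳ _ ⟨
    eval c x + 0#                ≈⟨ +-congˡ (zeroʳ (x - x₀)) ⟨
    eval c x + (x - x₀) * 0#     ∎
  eval-quotient {suc m} c x₀ x = begin
    eval c x
      ≈⟨ eval-suc c x ⟩
    head c + x * eval (tail c) x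
      ≈⟨ +-congˡ (*-congˡ (eval-quotient (tail c) x₀ x)) ⟩
    head c + x * (e₀ + (x - x₀) * q)
      ≈⟨ solve 5 (λ c x x₀ e₀ q → c :+ x :* (e₀ :+ (x :- x₀) :* q) := (c :+ x₀ :* e₀) :+ (x :- x₀) :* (e₀ :+ x :* q))
           ≈-refl (head c) x x₀ e₀ q ⟩
    (head c + x₀ * e₀) + (x - x₀) * (e₀ + x * q)
      ≈⟨ +-cong (eval-suc c x₀) (*-congˡ (eval-suc (quotient x₀ c) x)) ⟨
    eval c x₀ + (x - x₀) * eval (quotient x₀ c) x ∎
    where
    e₀ = eval (tail c) x₀
    q  = eval (quotient x₀ (tail c)) x

  head≈0 : ∀ {m} (c : Vector Carrier (suc m)) x → eval c x ≈ 0# → (∀ j → tail c j ≈ 0#) → head c ≈ 0#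
  head≈0 c x cx≈0 tail≈0 = begin
    head c                          ≈⟨ +-identityʳ (head c) ⟨
    head c + 0#                     ≈⟨ +-congˡ (≈-trans (*-congˡ (eval-0 (tail c) x tail≈0)) (zeroʳ x)) ⟨
    head c + x * eval (tail c) x    ≈⟨ eval-suc c x ⟨
    eval c x                        ≈⟨ cx≈0 ⟩
    0#                              ∎

  -- The coefficients are recovered from the top degree down: once those above vanish, the value at
  -- `x₀` that forms a quotient coefficient reduces to a single entry of `c`.
  quotient≈0 : ∀ {m} (c : Vector Carrier (suc m)) x₀ → (∀ j → quotient x₀ c j ≈ 0#) → ∀ j → tail c j ≈ 0#
  quotient≈0 {suc m} c x₀ q≈0 zero    = head≈0 (tail c) x₀ (q≈0 zero) (quotient≈0 (tail c) x₀ (q≈0 ∘ suc))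
  quotient≈0 {suc m} c x₀ q≈0 (suc j) = quotient≈0 (tail c) x₀ (q≈0 ∘ suc) j

  -- Injectivity of the Vandermonde matrix without determinants, as for a polynomial with more roots
  -- than its degree: divide by `x - head x`, cancel the regular difference at each remaining node,
  -- and apply induction to the quotient.
  eval-injective : ∀ {m} (x : Vector Carrier m) → (∀ {i j} → i ≢ j → Regular (x i - x j)) →
    ∀ (c : Vector Carrier m) → (∀ i → eval c (x i) ≈ 0#) → ∀ j → c j ≈ 0#
  eval-injective {zero}  x distinct c vanishes ()
  eval-injective {suc m} x distinct c vanishes = λ
    { zero    → head≈0 c (head x) (vanishes zero) tail≈0
    ; (suc j) → tail≈0 j
    }
    where
    q : Vector Carrier m
    q = quotient (head x) c

    q-vanishes : ∀ i → eval q (tail x i) ≈ 0#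
    q-vanishes i = distinct (λ ()) _ (begin
      (tail x i - head x) * eval q (tail x i)                        ≈⟨ +-identityˡ _ ⟨
      0# + (tail x i - head x) * eval q (tail x i)                   ≈⟨ +-congʳ (vanishes zero) ⟨
      eval c (head x) + (tail x i - head x) * eval q (tail x i)      ≈⟨ eval-quotient c (head x) (tail x i) ⟨
      eval c (tail x i)                                              ≈⟨ vanishes (suc i) ⟩
      0#                                                             ∎)

    tail≈0 : ∀ j → tail c j ≈ 0#
    tail≈0 = quotient≈0 c (head x)
      (eval-injective (tail x) (λ i≢j → distinct (i≢j ∘ Fin.suc-injective)) q q-vanishes)

open import Defs
open import Data.Rational.Base as ℚ using (ℚ; 0ℚ; 1ℚ; ½; ∣_∣; _<_; _≤_)
import Data.Rational.Properties as ℚ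
open import Data.Rational.Solver using () renaming (module +-*-Solver to ℚ-Solver)
open import Data.Rational.Unnormalised.Base as ℚᵘ using (mkℚᵘ; *≡*)
import Data.Rational.Unnormalised.Properties as ℚᵘ

-- Cauchy reals

IsNull : (ℕ → ℚ) → Set
IsNull u = ∀ ε → 0ℚ < ε → ∃[ N ] (∀ p → N ℕ.≤ p → ∣ u p ∣ < ε)

EventuallyBounded : (ℕ → ℚ) → Set
EventuallyBounded u = ∃[ B ] (0ℚ < B × ∃[ N ] (∀ p → N ℕ.≤ p → ∣ u p ∣ ≤ B))

abstract
  halve : ∀ {ε} → 0ℚ < ε → ∃[ δ ] (0ℚ < δ × δ ℚ.+ δ ≡ ε)
  halve {ε} 0<ε = ½ ℚ.* ε , ℚ.*-monoʳ-<-pos ½ 0<ε ,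
    ≡.trans (≡.sym (ℚ.*-distribʳ-+ ε ½ ½)) (ℚ.*-identityˡ ε)

  pos*pos : ∀ {p q} → 0ℚ < p → 0ℚ < q → 0ℚ < p ℚ.* q
  pos*pos {p} {q} 0<p 0<q =
    ℚ.positive⁻¹ (p ℚ.* q) {{ℚ.pos*pos⇒pos p {{ℚ.positive 0<p}} q {{ℚ.positive 0<q}}}}

  reciprocal : ∀ {p} → 0ℚ < p → ∃[ q ] (0ℚ < q × p ℚ.* q ≡ 1ℚ)
  reciprocal {p} 0<p = ℚ.1/ p , ℚ.positive⁻¹ (ℚ.1/ p) {{ℚ.1/pos⇒pos p}} , ℚ.*-inverseʳ p
    where
    instance
      p-pos : ℚ.Positive p
      p-pos = ℚ.positive 0<p
      p-nonZero : ℚ.NonZero p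
      p-nonZero = ℚ.pos⇒nonZero p

  ∣p∣≤∣p-q∣+∣q∣ : ∀ p q → ∣ p ∣ ≤ ∣ p ℚ.- q ∣ ℚ.+ ∣ q ∣
  ∣p∣≤∣p-q∣+∣q∣ p q = begin
    ∣ p ∣                    ≡⟨ ≡.cong ∣_∣ (solve 2 (λ p q → p := (p :- q) :+ q) ≡.refl p q) ⟩
    ∣ (p ℚ.- q) ℚ.+ q ∣      ≤⟨ ℚ.∣p+q∣≤∣p∣+∣q∣ (p ℚ.- q) q ⟩
    ∣ p ℚ.- q ∣ ℚ.+ ∣ q ∣    ∎
    where
    open ℚ.≤-Reasoning
    open ℚ-Solver

  null-dominated : ∀ {u v} → (∀ p → ∣ v p ∣ ≤ ∣ u p ∣) → IsNull u → IsNull v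
  null-dominated v≤u u→0 ε 0<ε with u→0 ε 0<ε
  ... | N , small = N , λ p N≤p → ℚ.≤-<-trans (v≤u p) (small p N≤p)

  null-resp : ∀ {u v} → (∀ p → u p ≡ v p) → IsNull u → IsNull v
  null-resp u≡v = null-dominated (λ p → ℚ.≤-reflexive (≡.cong ∣_∣ (≡.sym (u≡v p))))

  null-zero : IsNull (λ _ → 0ℚ)
  null-zero ε 0<ε = 0 , λ _ _ → 0<ε

  null-neg : ∀ {u} → IsNull u → IsNull (λ p → ℚ.- u p)
  null-neg {u} = null-dominated (λ p → ℚ.≤-reflexive (ℚ.∣-p∣≡∣p∣ (u p)))

  null-+ : ∀ {u v} → IsNull u → IsNull v → IsNull (λ p → u p ℚ.+ v p)
  null-+ {u} {v} u→0 v→0 ε 0<ε =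
    let δ , 0<δ , δ+δ≡ε = halve 0<ε
        M , h = u→0 δ 0<δ
        N , k = v→0 δ 0<δ
    in M ℕ.⊔ N , λ p ≤p → begin-strict
      ∣ u p ℚ.+ v p ∣          ≤⟨ ℚ.∣p+q∣≤∣p∣+∣q∣ (u p) (v p) ⟩
      ∣ u p ∣ ℚ.+ ∣ v p ∣      <⟨ ℚ.+-mono-< (h p (ℕ.m⊔n≤o⇒m≤o M N ≤p)) (k p (ℕ.m⊔n≤o⇒n≤o M N ≤p)) ⟩
      δ ℚ.+ δ                  ≡⟨ δ+δ≡ε ⟩
      ε                        ∎
    where open ℚ.≤-Reasoning

  bounded*null : ∀ {b u} → EventuallyBounded b → IsNull u → IsNull (λ p → b p ℚ.* u p)
  bounded*null {b} {u} (B , 0<B , M , ≤B) u→0 ε 0<ε =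
    let C , 0<C , BC≡1 = reciprocal 0<B
        N , small = u→0 (C ℚ.* ε) (pos*pos 0<C 0<ε)
    in M ℕ.⊔ N , λ p ≤p → begin-strict
      ∣ b p ℚ.* u p ∣        ≡⟨ ℚ.∣p*q∣≡∣p∣*∣q∣ (b p) (u p) ⟩
      ∣ b p ∣ ℚ.* ∣ u p ∣    ≤⟨ ℚ.*-monoʳ-≤-nonNeg ∣ u p ∣ {{ℚ.∣-∣-nonNeg (u p)}} (≤B p (ℕ.m⊔n≤o⇒m≤o M N ≤p)) ⟩
      B ℚ.* ∣ u p ∣          <⟨ ℚ.*-monoʳ-<-pos B {{ℚ.positive 0<B}} (small p (ℕ.m⊔n≤o⇒n≤o M N ≤p)) ⟩
      B ℚ.* (C ℚ.* ε)        ≡⟨ ℚ.*-assoc B C ε ⟨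
      B ℚ.* C ℚ.* ε          ≡⟨ ≡.cong (ℚ._* ε) BC≡1 ⟩
      1ℚ ℚ.* ε               ≡⟨ ℚ.*-identityˡ ε ⟩
      ε                      ∎
    where open ℚ.≤-Reasoning

  cauchy⇒bounded : ∀ {u} → IsCauchy u → EventuallyBounded u
  cauchy⇒bounded {u} cu with cu 1ℚ (ℚ.positive⁻¹ 1ℚ)
  ... | N , close =
    1ℚ ℚ.+ ∣ u N ∣ , ℚ.+-mono-<-≤ (ℚ.positive⁻¹ 1ℚ) (ℚ.0≤∣p∣ (u N)) , N , λ p N≤p →
      ℚ.≤-trans (∣p∣≤∣p-q∣+∣q∣ (u p) (u N))
        (ℚ.+-monoˡ-≤ ∣ u N ∣ (ℚ.<⇒≤ (close p N N≤p ℕ.≤-refl)))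

  -- A Cauchy sequence v is, for each ε, either eventually below ε or bounded away
  -- from 0; in the second case u * v → 0 would force u → 0.
  null-cancel : ∀ {u v} → ¬ IsNull u → IsCauchy v → IsNull (λ p → u p ℚ.* v p) → IsNull v
  null-cancel {u} {v} u↛0 cv uv→0 ε 0<ε = cases (halve 0<ε)
    where
    open ℚ.≤-Reasoning

    Goal : Set
    Goal = ∃[ N ] (∀ p → N ℕ.≤ p → ∣ v p ∣ < ε)

    away⇒null : ∀ η → 0ℚ < η → ∀ N → (∀ p → N ℕ.≤ p → η ≤ ∣ v p ∣) → IsNull u
    away⇒null η 0<η N away δ 0<δ with uv→0 (δ ℚ.* η) (pos*pos 0<δ 0<η)
    ... | M , small = N ℕ.⊔ M , λ p ≤p →
      ℚ.*-cancelʳ-<-nonNeg η {{ℚ.nonNegative (ℚ.<⇒≤ 0<η)}} (begin-strict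
        ∣ u p ∣ ℚ.* η          ≤⟨ ℚ.*-monoˡ-≤-nonNeg ∣ u p ∣ {{ℚ.∣-∣-nonNeg (u p)}} (away p (ℕ.m⊔n≤o⇒m≤o N M ≤p)) ⟩
        ∣ u p ∣ ℚ.* ∣ v p ∣    ≡⟨ ℚ.∣p*q∣≡∣p∣*∣q∣ (u p) (v p) ⟨
        ∣ u p ℚ.* v p ∣        <⟨ small p (ℕ.m⊔n≤o⇒n≤o N M ≤p) ⟩
        δ ℚ.* η                ∎)

    cases : ∃[ δ ] (0ℚ < δ × δ ℚ.+ δ ≡ ε) → Goal
    cases (δ , 0<δ , δ+δ≡ε) with halve 0<δ
    ... | η , 0<η , η+η≡δ with cv η 0<η
    ...   | N , close with ∣ v N ∣ ℚ.<? δ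
    ...     | yes small = N , λ p N≤p → begin-strict
      ∣ v p ∣                          ≤⟨ ∣p∣≤∣p-q∣+∣q∣ (v p) (v N) ⟩
      ∣ v p ℚ.- v N ∣ ℚ.+ ∣ v N ∣      <⟨ ℚ.+-mono-< (close p N N≤p ℕ.≤-refl) small ⟩
      η ℚ.+ δ                          ≤⟨ ℚ.+-monoˡ-≤ δ (ℚ.≤-trans (ℚ.≤-reflexive (≡.sym (ℚ.+-identityʳ η))) (ℚ.+-monoʳ-≤ η (ℚ.<⇒≤ 0<η))) ⟩
      (η ℚ.+ η) ℚ.+ δ                  ≡⟨ ≡.cong (ℚ._+ δ) η+η≡δ ⟩
      δ ℚ.+ δ                          ≡⟨ δ+δ≡ε ⟩
      ε                                ∎
    ...     | no ≮δ = contradiction (away⇒null η 0<η N away) u↛0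
      where
      away : ∀ p → N ℕ.≤ p → η ≤ ∣ v p ∣
      away p N≤p = ℚ.≮⇒≥ λ v<η → ≮δ (begin-strict
        ∣ v N ∣                          ≤⟨ ∣p∣≤∣p-q∣+∣q∣ (v N) (v p) ⟩
        ∣ v N ℚ.- v p ∣ ℚ.+ ∣ v p ∣      <⟨ ℚ.+-mono-< (close N p ℕ.≤-refl N≤p) v<η ⟩
        η ℚ.+ η                          ≡⟨ η+η≡δ ⟩
        δ                                ∎)

  null-sqrt : ∀ {u} → IsNull (λ p → u p ℚ.* u p) → IsNull u
  null-sqrt {u} u²→0 ε 0<ε with u²→0 (ε ℚ.* ε) (pos*pos 0<ε 0<ε)
  ... | N , small = N , λ p N≤p → ℚ.≰⇒> λ ε≤u → ℚ.<-irrefl ≡.refl (ℚ.<-≤-trans (small p N≤p) (begin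
      ε ℚ.* ε                ≤⟨ ℚ.*-monoˡ-≤-nonNeg ε ε≤u ⟩
      ε ℚ.* ∣ u p ∣          ≤⟨ ℚ.*-monoʳ-≤-nonNeg ∣ u p ∣ {{ℚ.∣-∣-nonNeg (u p)}} ε≤u ⟩
      ∣ u p ∣ ℚ.* ∣ u p ∣    ≡⟨ ℚ.∣p*q∣≡∣p∣*∣q∣ (u p) (u p) ⟨
      ∣ u p ℚ.* u p ∣        ∎))
    where
    open ℚ.≤-Reasoning
    instance
      ε-nonNeg : ℚ.NonNegative ε
      ε-nonNeg = ℚ.nonNegative (ℚ.<⇒≤ 0<ε)

  p*p≥0 : ∀ p → 0ℚ ≤ p ℚ.* p
  p*p≥0 p = begin
    0ℚ                 ≤⟨ ℚ.0≤∣p∣ (p ℚ.* p) ⟩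
    ∣ p ℚ.* p ∣        ≡⟨ ℚ.∣p*q∣≡∣p∣*∣q∣ p p ⟩
    ∣ p ∣ ℚ.* ∣ p ∣    ≡⟨ sq p ⟩
    p ℚ.* p            ∎
    where
    open ℚ.≤-Reasoning
    open ℚ-Solver
    sq : ∀ p → ∣ p ∣ ℚ.* ∣ p ∣ ≡ p ℚ.* p
    sq p with ℚ.∣p∣≡p∨∣p∣≡-p p
    ... | inj₁ eq = ≡.cong₂ ℚ._*_ eq eq
    ... | inj₂ eq = ≡.trans (≡.cong₂ ℚ._*_ eq eq)
      (solve 1 (λ p → (:- p) :* (:- p) := p :* p) ≡.refl p)

  -- Both squares are nonnegative, so `u²` is dominated by the sum. This gives `z ≈ 0#` from the
  -- vanishing of `|z|²`.
  null-sqrt₂ : ∀ (u v : ℕ → ℚ) → IsNull (λ p → u p ℚ.* u p ℚ.+ v p ℚ.* v p) → IsNull u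
  null-sqrt₂ u v s→0 =
    null-sqrt {u} (null-dominated {λ p → u p ℚ.* u p ℚ.+ v p ℚ.* v p} {λ p → u p ℚ.* u p}
      (λ p → dominated (p*p≥0 (u p)) (p*p≥0 (v p))) s→0)
    where
    open ℚ.≤-Reasoning
    dominated : ∀ {x y} → 0ℚ ≤ x → 0ℚ ≤ y → ∣ x ∣ ≤ ∣ x ℚ.+ y ∣
    dominated {x} {y} 0≤x 0≤y = begin
      ∣ x ∣          ≡⟨ ℚ.0≤p⇒∣p∣≡p 0≤x ⟩
      x              ≡⟨ ℚ.+-identityʳ x ⟨
      x ℚ.+ 0ℚ       ≤⟨ ℚ.+-monoʳ-≤ x 0≤y ⟩
      x ℚ.+ y        ≡⟨ ℚ.0≤p⇒∣p∣≡p (ℚ.+-mono-≤ 0≤x 0≤y) ⟨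
      ∣ x ℚ.+ y ∣    ∎

abstract
  -- The ring operations act termwise, so a ring law for real or complex numbers holds exactly at
  -- every index; through this lemma it reduces to an identity of rationals.
  ≗⇒≈ᴿ : ∀ {x y} → (∀ p → seq x p ≡ seq y p) → x ≈ᴿ y
  ≗⇒≈ᴿ {x} {y} x≗y = mk≈ᴿ (null-resp {λ _ → 0ℚ} {λ p → seq x p ℚ.- seq y p}
    (λ p → ≡.trans (≡.sym (ℚ.+-inverseʳ (seq y p))) (≡.cong (ℚ._- seq y p) (≡.sym (x≗y p))))
    null-zero)

  ≈ᴿ-refl : ∀ {x} → x ≈ᴿ x
  ≈ᴿ-refl = ≗⇒≈ᴿ (λ _ → ≡.refl)

  ≈ᴿ-sym : ∀ {x y} → x ≈ᴿ y → y ≈ᴿ x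
  ≈ᴿ-sym {x} {y} (mk≈ᴿ d) = mk≈ᴿ (null-resp
    {λ p → ℚ.- (seq x p ℚ.- seq y p)} {λ p → seq y p ℚ.- seq x p}
    (λ p → solve 2 (λ x y → :- (x :- y) := y :- x) ≡.refl (seq x p) (seq y p))
    (null-neg {λ p → seq x p ℚ.- seq y p} d))
    where open ℚ-Solver

  ≈ᴿ-trans : ∀ {x y z} → x ≈ᴿ y → y ≈ᴿ z → x ≈ᴿ z
  ≈ᴿ-trans {x} {y} {z} (mk≈ᴿ d) (mk≈ᴿ e) = mk≈ᴿ (null-resp
    {λ p → (seq x p ℚ.- seq y p) ℚ.+ (seq y p ℚ.- seq z p)} {λ p → seq x p ℚ.- seq z p}
    (λ p → solve 3 (λ x y z → (x :- y) :+ (y :- z) := x :- z) ≡.refl (seq x p) (seq y p) (seq z p))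
    (null-+ {λ p → seq x p ℚ.- seq y p} {λ p → seq y p ℚ.- seq z p} d e))
    where open ℚ-Solver

  +ᴿ-cong : ∀ {x x′ y y′} → x ≈ᴿ x′ → y ≈ᴿ y′ → x +ᴿ y ≈ᴿ x′ +ᴿ y′
  +ᴿ-cong {x} {x′} {y} {y′} (mk≈ᴿ d) (mk≈ᴿ e) = mk≈ᴿ (null-resp
    {λ p → (seq x p ℚ.- seq x′ p) ℚ.+ (seq y p ℚ.- seq y′ p)}
    {λ p → (seq x p ℚ.+ seq y p) ℚ.- (seq x′ p ℚ.+ seq y′ p)}
    (λ p → solve 4 (λ x x′ y y′ → (x :- x′) :+ (y :- y′) := (x :+ y) :- (x′ :+ y′)) ≡.refl
      (seq x p) (seq x′ p) (seq y p) (seq y′ p))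
    (null-+ {λ p → seq x p ℚ.- seq x′ p} {λ p → seq y p ℚ.- seq y′ p} d e))
    where open ℚ-Solver

  -ᴿ-cong : ∀ {x y} → x ≈ᴿ y → -ᴿ x ≈ᴿ -ᴿ y
  -ᴿ-cong {x} {y} (mk≈ᴿ d) = mk≈ᴿ (null-resp
    {λ p → ℚ.- (seq x p ℚ.- seq y p)} {λ p → (ℚ.- seq x p) ℚ.- (ℚ.- seq y p)}
    (λ p → solve 2 (λ x y → :- (x :- y) := (:- x) :- (:- y)) ≡.refl (seq x p) (seq y p))
    (null-neg {λ p → seq x p ℚ.- seq y p} d))
    where open ℚ-Solver

  *ᴿ-cong : ∀ {x x′ y y′} → x ≈ᴿ x′ → y ≈ᴿ y′ → x *ᴿ y ≈ᴿ x′ *ᴿ y′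
  *ᴿ-cong {x} {x′} {y} {y′} (mk≈ᴿ d) (mk≈ᴿ e) = mk≈ᴿ (null-resp
    {λ p → seq x p ℚ.* (seq y p ℚ.- seq y′ p) ℚ.+ seq y′ p ℚ.* (seq x p ℚ.- seq x′ p)}
    {λ p → (seq x p ℚ.* seq y p) ℚ.- (seq x′ p ℚ.* seq y′ p)}
    (λ p → solve 4 (λ x x′ y y′ → x :* (y :- y′) :+ y′ :* (x :- x′) := (x :* y) :- (x′ :* y′)) ≡.refl
      (seq x p) (seq x′ p) (seq y p) (seq y′ p))
    (null-+ {λ p → seq x p ℚ.* (seq y p ℚ.- seq y′ p)} {λ p → seq y′ p ℚ.* (seq x p ℚ.- seq x′ p)}
      (bounded*null {seq x} {λ p → seq y p ℚ.- seq y′ p} (cauchy⇒bounded (cauchy x)) e)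
      (bounded*null {seq y′} {λ p → seq x p ℚ.- seq x′ p} (cauchy⇒bounded (cauchy y′)) d)))
    where open ℚ-Solver

  0ᴿ-null : ∀ {x} → x ≈ᴿ fromℚ 0ℚ → IsNull (seq x)
  0ᴿ-null {x} (mk≈ᴿ d) = null-resp {λ p → seq x p ℚ.- 0ℚ} {seq x} (λ p → ℚ.+-identityʳ (seq x p)) d

  null-0ᴿ : ∀ {x} → IsNull (seq x) → x ≈ᴿ fromℚ 0ℚ
  null-0ᴿ {x} d = mk≈ᴿ (null-resp {seq x} {λ p → seq x p ℚ.- 0ℚ} (λ p → ≡.sym (ℚ.+-identityʳ (seq x p))) d)

  *ᴿ-cancel : ∀ {x y} → ¬ x ≈ᴿ fromℚ 0ℚ → x *ᴿ y ≈ᴿ fromℚ 0ℚ → y ≈ᴿ fromℚ 0ℚ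
  *ᴿ-cancel {x} {y} x≉0 xy≈0 =
    null-0ᴿ (null-cancel {seq x} {seq y} (λ x→0 → x≉0 (null-0ᴿ x→0)) (cauchy y) (0ᴿ-null xy≈0))

  squares≈0 : ∀ {x y} → x *ᴿ x +ᴿ y *ᴿ y ≈ᴿ fromℚ 0ℚ → x ≈ᴿ fromℚ 0ℚ
  squares≈0 {x} {y} s≈0 = null-0ᴿ (null-sqrt₂ (seq x) (seq y) (0ᴿ-null s≈0))

  pointwise≥1⇒≉0 : ∀ {x} → (∀ p → 1ℚ ≤ seq x p) → ¬ x ≈ᴿ fromℚ 0ℚ
  pointwise≥1⇒≉0 {x} 1≤x x≈0 with 0ᴿ-null x≈0 1ℚ (ℚ.positive⁻¹ 1ℚ)
  ... | N , small = ℚ.<-irrefl ≡.refl (ℚ.≤-<-trans (1≤x N) (≡.subst (_< 1ℚ)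
    (ℚ.0≤p⇒∣p∣≡p (ℚ.≤-trans (ℚ.<⇒≤ (ℚ.positive⁻¹ 1ℚ)) (1≤x N))) (small N ℕ.≤-refl)))

-- The complex numbers as a commutative ring

reₚ imₚ : ℂ → ℕ → ℚ
reₚ z p = seq (re z) p
imₚ z p = seq (im z) p

abstract
  ≗⇒≈ : ∀ {z w} → (∀ p → reₚ z p ≡ reₚ w p) → (∀ p → imₚ z p ≡ imₚ w p) → z ≈ w
  ≗⇒≈ re≗ im≗ = mk≈ᶜ (≗⇒≈ᴿ re≗) (≗⇒≈ᴿ im≗)

  ℂ-isCommutativeRing : IsCommutativeRing _≈_ _+_ _*_ -_ 0# 1#
  ℂ-isCommutativeRing = record
    { isRing = record
      { +-isAbelianGroup = record
        { isGroup = record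
          { isMonoid = record
            { isSemigroup = record
              { isMagma = record
                { isEquivalence = record
                  { refl  = mk≈ᶜ ≈ᴿ-refl ≈ᴿ-refl
                  ; sym   = λ (mk≈ᶜ d e) → mk≈ᶜ (≈ᴿ-sym d) (≈ᴿ-sym e)
                  ; trans = λ (mk≈ᶜ d e) (mk≈ᶜ d′ e′) → mk≈ᶜ (≈ᴿ-trans d d′) (≈ᴿ-trans e e′)
                  }
                ; ∙-cong = λ (mk≈ᶜ d e) (mk≈ᶜ d′ e′) → mk≈ᶜ (+ᴿ-cong d d′) (+ᴿ-cong e e′)
                }
              ; assoc = λ z w v → ≗⇒≈
                  (λ p → ℚ.+-assoc (reₚ z p) (reₚ w p) (reₚ v p))
                  (λ p → ℚ.+-assoc (imₚ z p) (imₚ w p) (imₚ v p))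
              }
            ; identity =
                (λ z → ≗⇒≈ (λ p → ℚ.+-identityˡ (reₚ z p)) (λ p → ℚ.+-identityˡ (imₚ z p)))
              , (λ z → ≗⇒≈ (λ p → ℚ.+-identityʳ (reₚ z p)) (λ p → ℚ.+-identityʳ (imₚ z p)))
            }
          ; inverse =
              (λ z → ≗⇒≈ (λ p → ℚ.+-inverseˡ (reₚ z p)) (λ p → ℚ.+-inverseˡ (imₚ z p)))
            , (λ z → ≗⇒≈ (λ p → ℚ.+-inverseʳ (reₚ z p)) (λ p → ℚ.+-inverseʳ (imₚ z p)))
          ; ⁻¹-cong = λ (mk≈ᶜ d e) → mk≈ᶜ (-ᴿ-cong d) (-ᴿ-cong e)
          }
        ; comm = λ z w → ≗⇒≈
            (λ p → ℚ.+-comm (reₚ z p) (reₚ w p))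
            (λ p → ℚ.+-comm (imₚ z p) (imₚ w p))
        }
      ; *-cong = λ (mk≈ᶜ d e) (mk≈ᶜ d′ e′) → mk≈ᶜ
          (+ᴿ-cong (*ᴿ-cong d d′) (-ᴿ-cong (*ᴿ-cong e e′)))
          (+ᴿ-cong (*ᴿ-cong d e′) (*ᴿ-cong e d′))
      ; *-assoc = λ z w v → ≗⇒≈
          (λ p → solve 6 (λ a b c d e f →
            (a :* c :- b :* d) :* e :- (a :* d :+ b :* c) :* f :=
            a :* (c :* e :- d :* f) :- b :* (c :* f :+ d :* e)) ≡.refl
            (reₚ z p) (imₚ z p) (reₚ w p) (imₚ w p) (reₚ v p) (imₚ v p))
          (λ p → solve 6 (λ a b c d e f →
            (a :* c :- b :* d) :* f :+ (a :* d :+ b :* c) :* e :=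
            a :* (c :* f :+ d :* e) :+ b :* (c :* e :- d :* f)) ≡.refl
            (reₚ z p) (imₚ z p) (reₚ w p) (imₚ w p) (reₚ v p) (imₚ v p))
      ; *-identity =
          (λ z → ≗⇒≈
            (λ p → solve 2 (λ a b → con 1ℚ :* a :- con 0ℚ :* b := a) ≡.refl (reₚ z p) (imₚ z p))
            (λ p → solve 2 (λ a b → con 1ℚ :* b :+ con 0ℚ :* a := b) ≡.refl (reₚ z p) (imₚ z p)))
        , (λ z → ≗⇒≈
            (λ p → solve 2 (λ a b → a :* con 1ℚ :- b :* con 0ℚ := a) ≡.refl (reₚ z p) (imₚ z p))
            (λ p → solve 2 (λ a b → a :* con 0ℚ :+ b :* con 1ℚ := b) ≡.refl (reₚ z p) (imₚ z p)))
      ; distrib =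
          (λ z w v → ≗⇒≈
            (λ p → solve 6 (λ a b c d e f →
              a :* (c :+ e) :- b :* (d :+ f) := (a :* c :- b :* d) :+ (a :* e :- b :* f)) ≡.refl
              (reₚ z p) (imₚ z p) (reₚ w p) (imₚ w p) (reₚ v p) (imₚ v p))
            (λ p → solve 6 (λ a b c d e f →
              a :* (d :+ f) :+ b :* (c :+ e) := (a :* d :+ b :* c) :+ (a :* f :+ b :* e)) ≡.refl
              (reₚ z p) (imₚ z p) (reₚ w p) (imₚ w p) (reₚ v p) (imₚ v p)))
        , (λ v z w → ≗⇒≈
            (λ p → solve 6 (λ a b c d e f →
              (c :+ e) :* a :- (d :+ f) :* b := (c :* a :- d :* b) :+ (e :* a :- f :* b)) ≡.refl
              (reₚ v p) (imₚ v p) (reₚ z p) (imₚ z p) (reₚ w p) (imₚ w p))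
            (λ p → solve 6 (λ a b c d e f →
              (c :+ e) :* b :+ (d :+ f) :* a := (c :* b :+ d :* a) :+ (e :* b :+ f :* a)) ≡.refl
              (reₚ v p) (imₚ v p) (reₚ z p) (imₚ z p) (reₚ w p) (imₚ w p)))
      }
    ; *-comm = λ z w → ≗⇒≈
        (λ p → solve 4 (λ a b c d → a :* c :- b :* d := c :* a :- d :* b) ≡.refl
          (reₚ z p) (imₚ z p) (reₚ w p) (imₚ w p))
        (λ p → solve 4 (λ a b c d → a :* d :+ b :* c := c :* b :+ d :* a) ≡.refl
          (reₚ z p) (imₚ z p) (reₚ w p) (imₚ w p))
    }
    where open ℚ-Solver

ℂ-commutativeRing : CommutativeRing 0ℓ 0ℓ
ℂ-commutativeRing = record { isCommutativeRing = ℂ-isCommutativeRing }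

module ℂR = CommutativeRing ℂ-commutativeRing

abstract
  conj-cong : ∀ {z w} → z ≈ w → conj z ≈ conj w
  conj-cong (mk≈ᶜ d e) = mk≈ᶜ d (-ᴿ-cong e)

  conj-+ : ∀ z w → conj (z + w) ≈ conj z + conj w
  conj-+ z w = ≗⇒≈ (λ _ → ≡.refl) (λ p → ℚ.neg-distrib-+ (imₚ z p) (imₚ w p))

  conj-* : ∀ z w → conj (z * w) ≈ conj z * conj w
  conj-* z w = ≗⇒≈
    (λ p → solve 4 (λ a b c d → a :* c :- b :* d := a :* c :- (:- b) :* (:- d)) ≡.refl
      (reₚ z p) (imₚ z p) (reₚ w p) (imₚ w p))
    (λ p → solve 4 (λ a b c d → :- (a :* d :+ b :* c) := a :* (:- d) :+ (:- b) :* c) ≡.refl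
      (reₚ z p) (imₚ z p) (reₚ w p) (imₚ w p))
    where open ℚ-Solver

  conj-involutive : ∀ z → conj (conj z) ≈ z
  conj-involutive z = ≗⇒≈ (λ _ → ≡.refl) (λ p → solve 1 (λ b → :- (:- b) := b) ≡.refl (imₚ z p))
    where open ℚ-Solver

  conj-fromℚ : ∀ q → conj (fromℚ q +i fromℚ 0ℚ) ≈ fromℚ q +i fromℚ 0ℚ
  conj-fromℚ q = ≗⇒≈ (λ _ → ≡.refl) (λ _ → ≡.refl)

  -- Multiplying `z * w` by `conj z` gives `N * w` with the real number `N = |z|²`, so cancellation
  -- in the reals applies to each part of `w` separately. `N` is not zero, because a vanishing sum
  -- of two squares forces both parts of `z` to vanish.
  ≉0⇒regular : ∀ {z} → ¬ z ≈ 0# → ∀ w → z * w ≈ 0# → w ≈ 0#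
  ≉0⇒regular {z} z≉0 w (mk≈ᶜ zw≈0₁ zw≈0₂) = mk≈ᶜ
    (*ᴿ-cancel {N} {re w} N≉0 (≈ᴿ-trans
      (≗⇒≈ᴿ {N *ᴿ re w} {re z *ᴿ re (z * w) +ᴿ im z *ᴿ im (z * w)} λ p →
        solve 4 (λ a b c d → (a :* a :+ b :* b) :* c := a :* (a :* c :- b :* d) :+ b :* (a :* d :+ b :* c))
          ≡.refl (reₚ z p) (imₚ z p) (reₚ w p) (imₚ w p))
      (combination (re z) (im z) zw≈0₁ zw≈0₂)))
    (*ᴿ-cancel {N} {im w} N≉0 (≈ᴿ-trans
      (≗⇒≈ᴿ {N *ᴿ im w} {re z *ᴿ im (z * w) +ᴿ (-ᴿ im z) *ᴿ re (z * w)} λ p →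
        solve 4 (λ a b c d → (a :* a :+ b :* b) :* d := a :* (a :* d :+ b :* c) :+ (:- b) :* (a :* c :- b :* d))
          ≡.refl (reₚ z p) (imₚ z p) (reₚ w p) (imₚ w p))
      (combination (re z) (-ᴿ im z) zw≈0₂ zw≈0₁)))
    where
    open ℚ-Solver
    N : ℝ
    N = re z *ᴿ re z +ᴿ im z *ᴿ im z

    N≉0 : ¬ N ≈ᴿ fromℚ 0ℚ
    N≉0 N≈0 = z≉0 (mk≈ᶜ (squares≈0 {re z} {im z} N≈0)
      (squares≈0 {im z} {re z} (≈ᴿ-trans
        (≗⇒≈ᴿ {im z *ᴿ im z +ᴿ re z *ᴿ re z} {N}
          λ p → ℚ.+-comm (imₚ z p ℚ.* imₚ z p) (reₚ z p ℚ.* reₚ z p))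
        N≈0)))

    combination : ∀ a b {x y} → x ≈ᴿ fromℚ 0ℚ → y ≈ᴿ fromℚ 0ℚ → a *ᴿ x +ᴿ b *ᴿ y ≈ᴿ fromℚ 0ℚ
    combination a b {x} {y} x≈0 y≈0 = ≈ᴿ-trans
      (+ᴿ-cong (*ᴿ-cong {a} {a} ≈ᴿ-refl x≈0) (*ᴿ-cong {b} {b} ≈ᴿ-refl y≈0))
      (≗⇒≈ᴿ {a *ᴿ fromℚ 0ℚ +ᴿ b *ᴿ fromℚ 0ℚ} {fromℚ 0ℚ} λ p →
        solve 2 (λ a b → a :* con 0ℚ :+ b :* con 0ℚ := con 0ℚ) ≡.refl (seq a p) (seq b p))

-- The integers inside the complex numbers.

/1-homo-+ : ∀ a b → (a ℤ.+ b) ℚ./ 1 ≡ a ℚ./ 1 ℚ.+ b ℚ./ 1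
-- `ℚ._/_` divides out a gcd and does not compute on variables; among unnormalised fractions the
-- claim is a cross-multiplication of integers.
/1-homo-+ a b = ℚ.toℚᵘ-injective (begin
  ℚ.toℚᵘ ((a ℤ.+ b) ℚ./ 1)                        ≈⟨ ℚ.toℚᵘ-fromℚᵘ (mkℚᵘ (a ℤ.+ b) 0) ⟩
  mkℚᵘ (a ℤ.+ b) 0                                ≈⟨ *≡* (solve 2 (λ a b → (a :+ b) :* con (+ 1) := (a :* con (+ 1) :+ b :* con (+ 1)) :* con (+ 1)) ≡.refl a b) ⟩
  mkℚᵘ a 0 ℚᵘ.+ mkℚᵘ b 0                          ≈⟨ ℚᵘ.+-cong (ℚ.toℚᵘ-fromℚᵘ (mkℚᵘ a 0)) (ℚ.toℚᵘ-fromℚᵘ (mkℚᵘ b 0)) ⟨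
  ℚ.toℚᵘ (a ℚ./ 1) ℚᵘ.+ ℚ.toℚᵘ (b ℚ./ 1)          ≈⟨ ℚ.toℚᵘ-homo-+ (a ℚ./ 1) (b ℚ./ 1) ⟨
  ℚ.toℚᵘ (a ℚ./ 1 ℚ.+ b ℚ./ 1)                    ∎)
  where
  open ℚᵘ.≃-Reasoning
  open ℤ-Solver

/1-homo-* : ∀ a b → (a ℤ.* b) ℚ./ 1 ≡ a ℚ./ 1 ℚ.* (b ℚ./ 1)
/1-homo-* a b = ℚ.toℚᵘ-injective (begin
  ℚ.toℚᵘ ((a ℤ.* b) ℚ./ 1)                        ≈⟨ ℚ.toℚᵘ-fromℚᵘ (mkℚᵘ (a ℤ.* b) 0) ⟩
  mkℚᵘ a 0 ℚᵘ.* mkℚᵘ b 0                          ≈⟨ ℚᵘ.*-cong (ℚ.toℚᵘ-fromℚᵘ (mkℚᵘ a 0)) (ℚ.toℚᵘ-fromℚᵘ (mkℚᵘ b 0)) ⟨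
  ℚ.toℚᵘ (a ℚ./ 1) ℚᵘ.* ℚ.toℚᵘ (b ℚ./ 1)          ≈⟨ ℚ.toℚᵘ-homo-* (a ℚ./ 1) (b ℚ./ 1) ⟨
  ℚ.toℚᵘ (a ℚ./ 1 ℚ.* (b ℚ./ 1))                  ∎)
  where open ℚᵘ.≃-Reasoning

/1-homo-neg : ∀ a → (ℤ.- a) ℚ./ 1 ≡ ℚ.- (a ℚ./ 1)
/1-homo-neg a = ℚ.toℚᵘ-injective (begin
  ℚ.toℚᵘ ((ℤ.- a) ℚ./ 1)        ≈⟨ ℚ.toℚᵘ-fromℚᵘ (mkℚᵘ (ℤ.- a) 0) ⟩
  ℚᵘ.- mkℚᵘ a 0                 ≈⟨ ℚᵘ.-‿cong (ℚ.toℚᵘ-fromℚᵘ (mkℚᵘ a 0)) ⟨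
  ℚᵘ.- ℚ.toℚᵘ (a ℚ./ 1)         ≈⟨ ℚ.toℚᵘ-homo‿- (a ℚ./ 1) ⟨
  ℚ.toℚᵘ (ℚ.- (a ℚ./ 1))        ∎)
  where open ℚᵘ.≃-Reasoning

abstract
  fromℤ-+ : ∀ a b → fromℤ (a ℤ.+ b) ≈ fromℤ a + fromℤ b
  fromℤ-+ a b = ≗⇒≈ (λ _ → /1-homo-+ a b) (λ _ → ≡.refl)

  fromℤ-* : ∀ a b → fromℤ (a ℤ.* b) ≈ fromℤ a * fromℤ b
  fromℤ-* a b = ≗⇒≈
    (λ _ → ≡.trans (/1-homo-* a b)
      (solve 2 (λ x y → x :* y := x :* y :- con 0ℚ :* con 0ℚ) ≡.refl (a ℚ./ 1) (b ℚ./ 1)))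
    (λ _ → solve 2 (λ x y → con 0ℚ := x :* con 0ℚ :+ con 0ℚ :* y) ≡.refl (a ℚ./ 1) (b ℚ./ 1))
    where open ℚ-Solver

  fromℤ-neg : ∀ a → fromℤ (ℤ.- a) ≈ - fromℤ a
  fromℤ-neg a = ≗⇒≈ (λ _ → /1-homo-neg a) (λ _ → ≡.refl)

  fromℚ-inverse : ∀ {q r} → q ℚ.* r ≡ 1ℚ → (fromℚ q +i fromℚ 0ℚ) * (fromℚ r +i fromℚ 0ℚ) ≈ 1#
  fromℚ-inverse {q} {r} qr≡1 = ≗⇒≈
    (λ _ → ≡.trans (solve 2 (λ x y → x :* y :- con 0ℚ :* con 0ℚ := x :* y) ≡.refl q r) qr≡1)
    (λ _ → solve 2 (λ x y → x :* con 0ℚ :+ con 0ℚ :* y := con 0ℚ) ≡.refl q r)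
    where open ℚ-Solver

  fromℤ-inverse : ∀ n → .{{NonZero n}} → ∃[ q ] fromℤ (+ n) * (fromℚ q +i fromℚ 0ℚ) ≈ 1#
  fromℤ-inverse (suc n) with reciprocal (ℚ.positive⁻¹ (+ suc n ℚ./ 1) {{ℚ.normalize-pos (suc n) 1}})
  ... | r , _ , qr≡1 = r , fromℚ-inverse qr≡1

-- With this map as `ι`, `Integral` is by definition the condition on entries in
-- `HasIntegerEntries`.
fromℤ-homomorphism : CommutativeRing.rawRing ℤ.+-*-commutativeRing -Raw-AlmostCommutative⟶ fromCommutativeRing ℂ-commutativeRing
fromℤ-homomorphism = record
  { ⟦_⟧    = fromℤ
  ; +-homo = fromℤ-+
  ; *-homo = fromℤ-*
  ; -‿homo = fromℤ-neg
  ; 0-homo = ≗⇒≈ (λ _ → ≡.refl) (λ _ → ≡.refl)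
  ; 1-homo = ≗⇒≈ (λ _ → ≡.refl) (λ _ → ≡.refl)
  }

open Cyclotomic ℂ-commutativeRing fromℤ-homomorphism
open Exp ℂR.commutativeSemiring using (^-congˡ; ^-distrib-*)
open SemiringSum ℂR.semiring using (sum-cong-≋; ∑-comm; *-distribˡ-sum; *-distribʳ-sum)
open Solver using (solve; _:=_; _:+_; _:*_; _:-_; :-_)
open SetoidReasoning ℂR.setoid

-- Conjugation, and roots of unity on the unit circle.

conj-^ : ∀ z k → conj (z ^ k) ≈ conj z ^ k
conj-^ z zero    = conj-fromℚ 1ℚ
conj-^ z (suc k) = ℂR.trans (conj-* z (z ^ k)) (ℂR.*-congˡ (conj-^ z k))

conj-sum : ∀ {m} (v : Vector ℂ m) → conj (sum v) ≈ sum (λ i → conj (v i))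
conj-sum {zero}  v = conj-fromℚ 0ℚ
conj-sum {suc m} v = ℂR.trans (conj-+ _ _) (ℂR.+-congˡ (conj-sum (λ i → v (suc i))))

-- A property of the representing sequences, not invariant under _≈_.
record Nonnegative (z : ℂ) : Set where
  constructor mkNonnegative
  field
    re≥0 : ∀ p → 0ℚ ℚ.≤ reₚ z p
    im≡0 : ∀ p → imₚ z p ≡ 0ℚ

nonnegative-+ : ∀ {z w} → Nonnegative z → Nonnegative w → Nonnegative (z + w)
nonnegative-+ (mkNonnegative a b) (mkNonnegative c d) =
  mkNonnegative (λ p → ℚ.+-mono-≤ (a p) (c p)) (λ p → ≡.cong₂ ℚ._+_ (b p) (d p))

nonnegative-* : ∀ {z w} → Nonnegative z → Nonnegative w → Nonnegative (z * w)
nonnegative-* {z} {w} (mkNonnegative a b) (mkNonnegative c d) = mkNonnegative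
  (λ p → ≡.subst (0ℚ ℚ.≤_) (re≡ p) (ℚ.nonNegative⁻¹ _
    {{ℚ.nonNeg*nonNeg⇒nonNeg (reₚ z p) {{ℚ.nonNegative (a p)}} (reₚ w p) {{ℚ.nonNegative (c p)}}}}))
  (λ p → ≡.trans (≡.cong₂ (λ x y → reₚ z p ℚ.* y ℚ.+ x ℚ.* reₚ w p) (b p) (d p))
    (solve₂ (λ x y → x ⊗′ con 0ℚ ⊕ con 0ℚ ⊗′ y ⊜ con 0ℚ) ≡.refl (reₚ z p) (reₚ w p)))
  where
  open ℚ-Solver using (con) renaming (solve to solveℚ; _:+_ to _⊕_; _:*_ to _⊗′_; _:-_ to _⊖_; _:=_ to _⊜_)
  solve₂ = solveℚ 2
  re≡ : ∀ p → reₚ z p ℚ.* reₚ w p ≡ reₚ (z * w) p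
  re≡ p = ≡.trans (solve₂ (λ x y → x ⊗′ y ⊜ x ⊗′ y ⊖ con 0ℚ ⊗′ con 0ℚ) ≡.refl (reₚ z p) (reₚ w p))
    (≡.cong₂ (λ x y → reₚ z p ℚ.* reₚ w p ℚ.- x ℚ.* y) (≡.sym (b p)) (≡.sym (d p)))

nonnegative-0 : Nonnegative 0#
nonnegative-0 = mkNonnegative (λ _ → ℚ.≤-refl) (λ _ → ≡.refl)

nonnegative-1 : Nonnegative 1#
nonnegative-1 = mkNonnegative (λ _ → ℚ.nonNegative⁻¹ 1ℚ) (λ _ → ≡.refl)

nonnegative-^ : ∀ {z} → Nonnegative z → ∀ k → Nonnegative (z ^ k)
nonnegative-^ z≥0 zero    = nonnegative-1
nonnegative-^ z≥0 (suc k) = nonnegative-* z≥0 (nonnegative-^ z≥0 k)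

nonnegative-sum : ∀ {m} (v : Vector ℂ m) → (∀ i → Nonnegative (v i)) → Nonnegative (sum v)
nonnegative-sum {zero}  v v≥0 = nonnegative-0
nonnegative-sum {suc m} v v≥0 = nonnegative-+ (v≥0 zero) (nonnegative-sum (λ i → v (suc i)) (λ i → v≥0 (suc i)))

-- The terms of `conj z * z` are `a² + b²` and `a b - b a`, so the sign is exact at every index.
-- Sums and products preserve this, and no order on the reals is required.
nonnegative-norm : ∀ z → Nonnegative (conj z * z)
nonnegative-norm z = mkNonnegative
  (λ p → ≡.subst (0ℚ ℚ.≤_) (solveℚ 2 (λ a b → a ⊗′ a ⊕ b ⊗′ b ⊜ a ⊗′ a ⊖ (⊝ b) ⊗′ b) ≡.refl (reₚ z p) (imₚ z p))
    (ℚ.+-mono-≤ (p*p≥0 (reₚ z p)) (p*p≥0 (imₚ z p))))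
  (λ p → solveℚ 2 (λ a b → a ⊗′ b ⊕ (⊝ b) ⊗′ a ⊜ con 0ℚ) ≡.refl (reₚ z p) (imₚ z p))
  where
  open ℚ-Solver using (con) renaming (solve to solveℚ; _:+_ to _⊕_; _:*_ to _⊗′_; _:-_ to _⊖_; _:=_ to _⊜_; :-_ to ⊝_)

-- Every term of the real part is at least 1. For `r = |z|²` this makes the geometric sum
-- `1 + r + ⋯ + rⁿ⁻¹` cancellable.
1+nonnegative≉0 : ∀ {z} → Nonnegative z → ¬ 1# + z ≈ 0#
1+nonnegative≉0 {z} (mkNonnegative re≥0 _) (mk≈ᶜ re≈0 _) =
  pointwise≥1⇒≉0 {re (1# + z)} (λ p → ℚ.≤-trans (ℚ.≤-reflexive (≡.sym (ℚ.+-identityʳ 1ℚ))) (ℚ.+-monoʳ-≤ 1ℚ (re≥0 p))) re≈0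

-- r = |z|² is a nonnegative real with rⁿ = 1, so (r − 1)(1 + r + ⋯ + rⁿ⁻¹) = 0.
root-of-unity-norm : ∀ n → .{{NonZero n}} → ∀ z → z ^ n ≈ 1# → conj z * z ≈ 1#
root-of-unity-norm n@(suc n′) z zⁿ≈1 = a-b≈0⇒a≈b (≉0⇒regular (1+nonnegative≉0 S≥0) (r + - 1#) (begin
  (1# + S) * (r + - 1#)       ≈⟨ ℂR.*-comm (1# + S) (r + - 1#) ⟩
  (r + - 1#) * (1# + S)       ≈⟨ geometric n r ⟩
  r ^ n + - 1#                ≈⟨ a≈b⇒a-b≈0 rⁿ≈1 ⟩
  0#                          ∎))
  where
  r S : ℂ
  r = conj z * z
  S = sum {n′} (λ k → r ^ suc (toℕ k))

  S≥0 : Nonnegative S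
  S≥0 = nonnegative-sum {n′} (λ k → r ^ suc (toℕ k)) (λ k → nonnegative-^ (nonnegative-norm z) (suc (toℕ k)))

  rⁿ≈1 : r ^ n ≈ 1#
  rⁿ≈1 = begin
    (conj z * z) ^ n            ≈⟨ ^-distrib-* (conj z) z n ⟩
    conj z ^ n * z ^ n          ≈⟨ ℂR.*-congʳ (conj-^ z n) ⟨
    conj (z ^ n) * z ^ n        ≈⟨ ℂR.*-cong (conj-cong zⁿ≈1) zⁿ≈1 ⟩
    conj 1# * 1#                ≈⟨ ℂR.*-identityʳ (conj 1#) ⟩
    conj 1#                     ≈⟨ conj-fromℚ 1ℚ ⟩
    1#                          ∎

-- Complex matrices

private variable
  r s t u : ℕ

≋-trans : {A B C : Matrix r s} → A ≋ B → B ≋ C → A ≋ C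
≋-trans A≋B B≋C i j = ℂR.trans (A≋B i j) (B≋C i j)

≋-sym : {A B : Matrix r s} → A ≋ B → B ≋ A
≋-sym A≋B i j = ℂR.sym (A≋B i j)

⊗-cong : {A A′ : Matrix r s} {B B′ : Matrix s t} → A ≋ A′ → B ≋ B′ → A ⊗ B ≋ A′ ⊗ B′
⊗-cong {s = s} A≋A′ B≋B′ i j = sum-cong-≋ {s} (λ k → ℂR.*-cong (A≋A′ i k) (B≋B′ k j))

⊗-assoc : (A : Matrix r s) (B : Matrix s t) (C : Matrix t u) → (A ⊗ B) ⊗ C ≋ A ⊗ (B ⊗ C)
⊗-assoc {s = s} {t = t} A B C i j = begin
  sum {t} (λ l → sum {s} (λ k → A i k * B k l) * C l j)
    ≈⟨ sum-cong-≋ {t} (λ l → *-distribʳ-sum {s} (C l j) (λ k → A i k * B k l)) ⟩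
  sum {t} (λ l → sum {s} (λ k → A i k * B k l * C l j))
    ≈⟨ ∑-comm {t} {s} (λ l k → A i k * B k l * C l j) ⟩
  sum {s} (λ k → sum {t} (λ l → A i k * B k l * C l j))
    ≈⟨ sum-cong-≋ {s} (λ k → ℂR.trans
         (sum-cong-≋ {t} (λ l → ℂR.*-assoc (A i k) (B k l) (C l j)))
         (ℂR.sym (*-distribˡ-sum {t} (A i k) (λ l → B k l * C l j)))) ⟩
  sum {s} (λ k → A i k * sum {t} (λ l → B k l * C l j)) ∎

ᴴ-cong : {A B : Matrix r s} → A ≋ B → A ᴴ ≋ B ᴴ
ᴴ-cong A≋B i j = conj-cong (A≋B j i)

ᴴ-involutive : (A : Matrix r s) → (A ᴴ) ᴴ ≋ A
ᴴ-involutive A i j = conj-involutive (A i j)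

⊗-ᴴ : (A : Matrix r s) (B : Matrix s t) → (A ⊗ B) ᴴ ≋ B ᴴ ⊗ A ᴴ
⊗-ᴴ {s = s} A B i j = ℂR.trans (conj-sum {s} (λ k → A j k * B k i))
  (sum-cong-≋ {s} (λ k → ℂR.trans (conj-* (A j k) (B k i)) (ℂR.*-comm (conj (A j k)) (conj (B k i)))))

sum-identity : (i : Fin r) (v : Vector ℂ r) → sum (λ k → identity i k * v k) ≈ v i
sum-identity {suc r} zero v = begin
  1# * v zero + sum {r} (λ k → 0# * v (suc k))
    ≈⟨ ℂR.+-cong (ℂR.*-identityˡ (v zero)) (ℂR.sym (*-distribˡ-sum {r} 0# (λ k → v (suc k)))) ⟩
  v zero + 0# * sum {r} (λ k → v (suc k))
    ≈⟨ ℂR.+-congˡ (ℂR.zeroˡ _) ⟩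
  v zero + 0#
    ≈⟨ ℂR.+-identityʳ (v zero) ⟩
  v zero ∎
sum-identity {suc r} (suc i) v = begin
  0# * v zero + sum {r} (λ k → identity i k * v (suc k))
    ≈⟨ ℂR.+-cong (ℂR.zeroˡ (v zero)) (sum-identity i (λ k → v (suc k))) ⟩
  0# + v (suc i)
    ≈⟨ ℂR.+-identityˡ (v (suc i)) ⟩
  v (suc i) ∎

identity-sym : (i j : Fin r) → identity i j ≡ identity j i
identity-sym zero    zero    = ≡.refl
identity-sym zero    (suc j) = ≡.refl
identity-sym (suc i) zero    = ≡.refl
identity-sym (suc i) (suc j) = identity-sym i j

conj-identity : (i j : Fin r) → conj (identity i j) ≈ identity i j
conj-identity zero    zero    = conj-fromℚ 1ℚ
conj-identity zero    (suc j) = conj-fromℚ 0ℚ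
conj-identity (suc i) zero    = conj-fromℚ 0ℚ
conj-identity (suc i) (suc j) = conj-identity i j

scalar-⊗ : ∀ z (A : Matrix r s) → (z · identity) ⊗ A ≋ z · A
scalar-⊗ {r = r} z A i j = begin
  sum {r} (λ k → z * identity i k * A k j)    ≈⟨ sum-cong-≋ {r} (λ k → ℂR.*-assoc z (identity i k) (A k j)) ⟩
  sum {r} (λ k → z * (identity i k * A k j))  ≈⟨ *-distribˡ-sum {r} z (λ k → identity i k * A k j) ⟨
  z * sum {r} (λ k → identity i k * A k j)    ≈⟨ ℂR.*-congˡ (sum-identity i (λ k → A k j)) ⟩
  z * A i j                                   ∎

⊗-scalar : ∀ z (A : Matrix r s) → A ⊗ (z · identity) ≋ z · A
⊗-scalar {s = s} z A i j = begin
  sum {s} (λ k → A i k * (z * identity k j))    ≈⟨ sum-cong-≋ {s} (λ k → ℂR.trans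
                                                     (ℂR.*-congˡ (ℂR.*-congˡ (ℂR.reflexive (identity-sym k j))))
                                                     (solve 3 (λ a z e → a :* (z :* e) := z :* (e :* a)) ℂR.refl (A i k) z (identity j k))) ⟩
  sum {s} (λ k → z * (identity j k * A i k))    ≈⟨ *-distribˡ-sum {s} z (λ k → identity j k * A i k) ⟨
  z * sum {s} (λ k → identity j k * A i k)      ≈⟨ ℂR.*-congˡ (sum-identity j (λ k → A i k)) ⟩
  z * A i j                                     ∎

≋-refl : {A : Matrix r s} → A ≋ A
≋-refl _ _ = ℂR.refl

scalar-ᴴ : ∀ q → ((fromℚ q +i fromℚ 0ℚ) · identity {r}) ᴴ ≋ (fromℚ q +i fromℚ 0ℚ) · identity
scalar-ᴴ q i j = begin
  conj (z * identity j i)         ≈⟨ conj-* z (identity j i) ⟩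
  conj z * conj (identity j i)    ≈⟨ ℂR.*-cong (conj-fromℚ q) (conj-identity j i) ⟩
  z * identity j i                ≡⟨ ≡.cong (z *_) (identity-sym j i) ⟩
  z * identity i j                ∎
  where z = fromℚ q +i fromℚ 0ℚ

AAᴴ-selfAdjoint : (A : Matrix r s) → (A ⊗ A ᴴ) ᴴ ≋ A ⊗ A ᴴ
AAᴴ-selfAdjoint A = ≋-trans (⊗-ᴴ A (A ᴴ)) (⊗-cong (ᴴ-involutive A) ≋-refl)

AᴴA-selfAdjoint : (A : Matrix r s) → (A ᴴ ⊗ A) ᴴ ≋ A ᴴ ⊗ A
AᴴA-selfAdjoint A = ≋-trans (⊗-ᴴ (A ᴴ) A) (⊗-cong ≋-refl (ᴴ-involutive A))

HasIntegerEntries-AAᴴ : (A : Matrix r s) → (∀ i j → Integral (A i j)) → HasIntegerEntries (A ⊗ A ᴴ)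
HasIntegerEntries-AAᴴ {s = s} A Aℤ i j = integral-sum {s} _ λ k → Integral-* (Aℤ i k) (integral-conj (Aℤ j k))
  where
  integral-conj : ∀ {z} → Integral z → Integral (conj z)
  integral-conj (k , z≈k) = k , ℂR.trans (conj-cong z≈k) (conj-fromℚ (k ℚ./ 1))

  integral-sum : ∀ {m} (v : Vector ℂ m) → (∀ i → Integral (v i)) → Integral (sum v)
  integral-sum {zero}  v vℤ = Integral-0
  integral-sum {suc m} v vℤ = Integral-+ (vℤ zero) (integral-sum (λ i → v (suc i)) (λ i → vℤ (suc i)))

isPrimitiveRoot⇒Primitive : ∀ {n z} → IsPrimitiveRoot n z → Primitive n z
isPrimitiveRoot⇒Primitive (zⁿ≈1 , order) = zⁿ≈1 , λ k 0<k k<n → ≉0⇒regular λ zᵏ-1≈0 → order k 0<k k<n (a-b≈0⇒a≈b zᵏ-1≈0)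

-- Orthogonality of the rows of powers and the inverse of the Gram matrix.

module _ (n : ℕ) .{{_ : NonZero n}} {m : ℕ} (ζ : Vector ℂ m) (ζⁿ≈1 : ∀ i → ζ i ^ n ≈ 1#)
  (distinct : ∀ {i j} → i ≢ j → Regular (ζ i + - ζ j)) where

  private
    N : ℂ
    N = fromℤ (+ n)

    V : Matrix m m
    V = vandermonde ζ

    W : Matrix m n
    W i k = ζ i ^ toℕ k

    unit : ∀ i → conj (ζ i) * ζ i ≈ 1#
    unit i = root-of-unity-norm n (ζ i) (ζⁿ≈1 i)

  row-product : ∀ i j → (W ⊗ W ᴴ) i j ≈ sum {n} (λ k → (ζ i * conj (ζ j)) ^ toℕ k)
  row-product i j = sum-cong-≋ {n} λ k → begin
    ζ i ^ toℕ k * conj (ζ j ^ toℕ k)    ≈⟨ ℂR.*-congˡ (conj-^ (ζ j) (toℕ k)) ⟩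
    ζ i ^ toℕ k * conj (ζ j) ^ toℕ k    ≈⟨ ^-distrib-* (ζ i) (conj (ζ j)) (toℕ k) ⟨
    (ζ i * conj (ζ j)) ^ toℕ k          ∎

  -- As `conj (ζ j)` inverts `ζ j`, the difference `ζ i - ζ j` is `ζ j` times
  -- `ζ i * conj (ζ j) - 1#`; whatever the second factor annihilates, the difference annihilates
  -- too.
  ratio-regular : ∀ {i j} → i ≢ j → Regular (ζ i * conj (ζ j) + - 1#)
  ratio-regular {i} {j} i≢j w eq = distinct i≢j w (begin
    (ζ i + - ζ j) * w
      ≈⟨ ℂR.*-congʳ (ℂR.+-congʳ (ℂR.trans (ℂR.sym (ℂR.*-identityʳ (ζ i))) (ℂR.*-congˡ (ℂR.sym (unit j))))) ⟩
    (ζ i * (conj (ζ j) * ζ j) + - ζ j) * w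
      ≈⟨ ℂR.*-congʳ (ℂR.+-congˡ (ℂR.-‿cong (ℂR.*-identityˡ (ζ j)))) ⟨
    (ζ i * (conj (ζ j) * ζ j) + - (1# * ζ j)) * w
      ≈⟨ solve 5 (λ a b c o w → (a :* (b :* c) :- o :* c) :* w := c :* ((a :* b :- o) :* w)) ℂR.refl
           (ζ i) (conj (ζ j)) (ζ j) 1# w ⟩
    ζ j * ((ζ i * conj (ζ j) + - 1#) * w)
      ≈⟨ ℂR.*-congˡ eq ⟩
    ζ j * 0#
      ≈⟨ ℂR.zeroʳ (ζ j) ⟩
    0# ∎)

  ratio-power : ∀ i j → (ζ i * conj (ζ j)) ^ n ≈ 1#
  ratio-power i j = begin
    (ζ i * conj (ζ j)) ^ n      ≈⟨ ^-distrib-* (ζ i) (conj (ζ j)) n ⟩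
    ζ i ^ n * conj (ζ j) ^ n    ≈⟨ ℂR.*-cong (ζⁿ≈1 i) (ℂR.trans (ℂR.sym (conj-^ (ζ j) n)) (conj-cong (ζⁿ≈1 j))) ⟩
    1# * conj 1#                ≈⟨ ℂR.*-identityˡ (conj 1#) ⟩
    conj 1#                     ≈⟨ conj-fromℚ 1ℚ ⟩
    1#                          ∎

  -- Each entry is a geometric sum with ratio `x = ζ i * conj (ζ j)` and `x ^ n ≈ 1#`. On the
  -- diagonal `x` is 1 and the sum counts `n` terms; off it, `x - 1#` is regular and multiplies the
  -- sum to zero.
  rows-orthogonal : W ⊗ W ᴴ ≋ N · identity
  rows-orthogonal i j with i Fin.≟ j
  ... | yes ≡.refl = begin
    sum {n} (λ k → W i k * conj (W i k))                  ≈⟨ row-product i i ⟩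
    sum {n} (λ k → (ζ i * conj (ζ i)) ^ toℕ k)            ≈⟨ sum-cong-≋ {n} (λ k → ℂR.trans
                                                              (^-congˡ (toℕ k) (ℂR.trans (ℂR.*-comm (ζ i) (conj (ζ i))) (unit i)))
                                                              (1^n≈1 (toℕ k))) ⟩
    sum {n} (λ _ → 1#)                                    ≈⟨ sum-1 n ⟩
    N                                                     ≈⟨ ℂR.*-identityʳ N ⟨
    N * 1#                                                ∎
  ... | no i≢j = begin
    sum {n} (λ k → W i k * conj (W j k))                  ≈⟨ row-product i j ⟩
    sum {n} (λ k → (ζ i * conj (ζ j)) ^ toℕ k)            ≈⟨ ratio-regular i≢j _ (ℂR.trans (geometric n _) (a≈b⇒a-b≈0 (ratio-power i j))) ⟩
    0#                                                    ≈⟨ ℂR.zeroʳ N ⟨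
    N * 0#                                                ∎

  -- A column of `X - Y` is the coefficient vector of a polynomial that vanishes at every `ζ i`. The
  -- factor `1#` in front of `Y` fits the shape of `eval-linear`.
  V-injective : {X Y : Matrix m m} → V ⊗ X ≋ V ⊗ Y → X ≋ Y
  V-injective {X} {Y} VX≋VY k j = a-b≈0⇒a≈b (ℂR.trans (ℂR.+-congˡ (ℂR.-‿cong (ℂR.sym (ℂR.*-identityˡ (Y k j)))))
    (eval-injective ζ distinct (λ l → X l j + - (1# * Y l j)) (λ i → begin
      eval (λ l → X l j + - (1# * Y l j)) (ζ i)
        ≈⟨ eval-linear 1# (λ l → X l j) (λ l → Y l j) (ζ i) ⟩
      eval (λ l → X l j) (ζ i) + - (1# * eval (λ l → Y l j) (ζ i))
        ≈⟨ ℂR.+-congˡ (ℂR.-‿cong (ℂR.*-identityˡ (eval (λ l → Y l j) (ζ i)))) ⟩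
      eval (λ l → X l j) (ζ i) + - eval (λ l → Y l j) (ζ i)
        ≈⟨ a≈b⇒a-b≈0 (ℂR.trans (swap X i) (ℂR.trans (VX≋VY i j) (ℂR.sym (swap Y i)))) ⟩
      0# ∎) k))
    where
    swap : ∀ (Z : Matrix m m) i → eval (λ l → Z l j) (ζ i) ≈ (V ⊗ Z) i j
    swap Z i = sum-cong-≋ {m} (λ l → ℂR.*-comm (Z l j) (ζ i ^ toℕ l))

  module _ (A : Matrix m n) (VA≋W : V ⊗ A ≋ W) where

    private
      B G : Matrix m m
      B = A ⊗ A ᴴ
      G = gram ζ

    VB≋WAᴴ : V ⊗ B ≋ W ⊗ A ᴴ
    VB≋WAᴴ = ≋-trans (≋-sym (⊗-assoc V A (A ᴴ))) (⊗-cong VA≋W ≋-refl)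

    -- The factors `A ᴴ` and `V ᴴ` recombine into `(V ⊗ A) ᴴ`, which is `W ᴴ`.
    VBVᴴ≋N : (V ⊗ B) ⊗ V ᴴ ≋ N · identity
    VBVᴴ≋N = ≋-trans (⊗-cong VB≋WAᴴ ≋-refl) (≋-trans (⊗-assoc W (A ᴴ) (V ᴴ))
      (≋-trans (⊗-cong {A = W} ≋-refl (≋-trans (≋-sym (⊗-ᴴ V A)) (ᴴ-cong VA≋W))) rows-orthogonal))

    BG≋N : B ⊗ G ≋ N · identity
    BG≋N = V-injective (≋-trans (≋-sym (⊗-assoc V B G))
      (≋-trans (≋-sym (⊗-assoc (V ⊗ B) (V ᴴ) V))
      (≋-trans (⊗-cong VBVᴴ≋N ≋-refl)
      (≋-trans (scalar-⊗ N V) (≋-sym (⊗-scalar N V))))))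

    -- `B` and `G` are self-adjoint and `N` is real, so this is the adjoint of `BG≋N`; no general
    -- passage from one-sided to two-sided inverses is involved.
    GB≋N : G ⊗ B ≋ N · identity
    GB≋N = ≋-trans (⊗-cong (≋-sym (AᴴA-selfAdjoint V)) (≋-sym (AAᴴ-selfAdjoint A)))
      (≋-trans (≋-sym (⊗-ᴴ B G)) (≋-trans (ᴴ-cong BG≋N) (scalar-ᴴ (+ n ℚ./ 1))))

    gram-inverse : (∀ j k → Integral (A j k)) →
      Σ[ G⁻¹ ∈ Matrix m m ] (IsInverse (gram ζ) G⁻¹ × HasIntegerEntries (N · G⁻¹))
    gram-inverse Aℤ with fromℤ-inverse n
    ... | q , Nq≈1 = n⁻¹ · B , (right , left) , λ i j →
      Integral-resp (ℂR.sym (N[n⁻¹z]≈z (B i j))) (HasIntegerEntries-AAᴴ A Aℤ i j)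
      where
      n⁻¹ : ℂ
      n⁻¹ = fromℚ q +i fromℚ 0ℚ

      N[n⁻¹z]≈z : ∀ z → N * (n⁻¹ * z) ≈ z
      N[n⁻¹z]≈z z = ℂR.trans (ℂR.sym (ℂR.*-assoc N n⁻¹ z)) (ℂR.trans (ℂR.*-congʳ Nq≈1) (ℂR.*-identityˡ z))

      n⁻¹[Nz]≈z : ∀ z → n⁻¹ * (N * z) ≈ z
      n⁻¹[Nz]≈z z = ℂR.trans (solve 3 (λ a b z → a :* (b :* z) := b :* (a :* z)) ℂR.refl n⁻¹ N z) (N[n⁻¹z]≈z z)

      right : G ⊗ (n⁻¹ · B) ≋ identity
      right i j = begin
        sum {m} (λ k → G i k * (n⁻¹ * B k j))    ≈⟨ sum-cong-≋ {m} (λ k → solve 3 (λ a z b → a :* (z :* b) := z :* (a :* b)) ℂR.refl (G i k) n⁻¹ (B k j)) ⟩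
        sum {m} (λ k → n⁻¹ * (G i k * B k j))    ≈⟨ *-distribˡ-sum {m} n⁻¹ (λ k → G i k * B k j) ⟨
        n⁻¹ * sum {m} (λ k → G i k * B k j)      ≈⟨ ℂR.*-congˡ (GB≋N i j) ⟩
        n⁻¹ * (N * identity i j)                 ≈⟨ n⁻¹[Nz]≈z (identity i j) ⟩
        identity i j                             ∎

      left : (n⁻¹ · B) ⊗ G ≋ identity
      left i j = begin
        sum {m} (λ k → n⁻¹ * B i k * G k j)      ≈⟨ sum-cong-≋ {m} (λ k → ℂR.*-assoc n⁻¹ (B i k) (G k j)) ⟩
        sum {m} (λ k → n⁻¹ * (B i k * G k j))    ≈⟨ *-distribˡ-sum {m} n⁻¹ (λ k → B i k * G k j) ⟨
        n⁻¹ * sum {m} (λ k → B i k * G k j)      ≈⟨ ℂR.*-congˡ (BG≋N i j) ⟩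
        n⁻¹ * (N * identity i j)                 ≈⟨ n⁻¹[Nz]≈z (identity i j) ⟩
        identity i j                             ∎

-- Separating `m` from `φ n` permits a case split. For `m = 0` all conditions are empty; otherwise
-- `ζ zero` is the primitive root from which the sieve starts.
gram-inverse-integral : ∀ n → .{{_ : NonZero n}} → ∀ {m} → φ n ≡ m → (ζ : Vector ℂ m) → ListsPrimitiveRoots n ζ →
  Σ[ G⁻¹ ∈ Matrix m m ] (IsInverse (gram ζ) G⁻¹ × HasIntegerEntries (fromℤ (+ n) · G⁻¹))
gram-inverse-integral n {zero}  _ ζ _ = (λ ()) , ((λ ()) , (λ ())) , λ ()
gram-inverse-integral n {suc m} φn≡ ζ listed =
  gram-inverse n ζ (λ i → proj₁ (sound i)) regular A VA≋W (λ j k → proj₁ (proj₂ (reduction (toℕ k))) j)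
  where
  open ListsPrimitiveRoots listed using (sound; distinct)
  open Sieve n (ζ zero) (isPrimitiveRoot⇒Primitive (sound zero))

  regular : ∀ {i j} → i ≢ j → Regular (ζ i + - ζ j)
  regular i≢j = ≉0⇒regular λ eq → i≢j (distinct (a-b≈0⇒a≈b eq))

  monic : ∃[ a ] ((∀ j → Integral (a j)) × (∀ z → homogenize cyclotomic (suc m) z ≈ z ^ suc m + eval {suc m} a z))
  monic = homogenize-monic cyclotomic (∏-constant (ζ zero ^_) coprimes) cyclotomic-integral (suc m)

  root : ∀ i → ζ i ^ suc m + eval (proj₁ monic) (ζ i) ≈ 0#
  root i = ℂR.trans (ℂR.sym (proj₂ (proj₂ monic) (ζ i)))
    -- `length coprimes` is `φ n` by definition, so `φn≡` identifies the degree of the cyclotomic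
    -- polynomial with the size of the matrix.
    (≡.subst (λ k → homogenize cyclotomic k (ζ i) ≈ 0#) φn≡ (cyclotomic-root (ζ i) (isPrimitiveRoot⇒Primitive (sound i))))

  reduction : ∀ k → ∃[ b ] ((∀ j → Integral (b j)) ×
    (∀ z → z ^ suc m + eval (proj₁ monic) z ≈ 0# → z ^ k ≈ eval {suc m} b z))
  reduction = power-reduction (proj₁ monic) (proj₁ (proj₂ monic))

  A : Matrix (suc m) n
  A j k = proj₁ (reduction (toℕ k)) j

  VA≋W : vandermonde ζ ⊗ A ≋ (λ i k → ζ i ^ toℕ k)
  VA≋W i k = ℂR.trans (sum-cong-≋ {suc m} (λ j → ℂR.*-comm (ζ i ^ toℕ j) (A j k)))
    (ℂR.sym (proj₂ (proj₂ (reduction (toℕ k))) (ζ i) (root i)))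

theorem1p3 : ∀ (n : ℕ) → .{{_ : NonZero n}} → (ζ : Vector ℂ (φ n)) → ListsPrimitiveRoots n ζ →
    Σ[ G⁻¹ ∈ Matrix (φ n) (φ n) ] (IsInverse (gram ζ) G⁻¹ × HasIntegerEntries (fromℤ (+ n) · G⁻¹))
theorem1p3 n = gram-inverse-integral n ≡.refl
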